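{- There exists an absolute constant $C > 0$ such that the following holds. Let $R$ be a ring, and let $A \subset R$ be finite and non-empty. Suppose that $|A + A \cdot A| \leq K |A|$ and $|A \cdot A| \geq |A|/K$ for some $K \geq 1$. Then at least one of the following holds: (i) ($A-A$ has many zero divisors) $|(A-A) \setminus R^*| \geq C^{ -1} K^{ -C} |A|$; or (ii) (Subring structure) there exists a finite subring $S$ of $R$ such that $A \subset S$ and $|S| \leq C K^C |A|$.
   Context: Rings are associative, but need not be commutative and need not contain a multiplicative identity; accordingly a subring is an additive subgroup closed under multiplication (no identity element is required). For subsets $A,B$ of a ring $R$: $A+B := \{a+b : a\in A, b\in B\}$, $A-B := \{a-b : a \in A, b\in B\}$, $A\cdot B := \{ab : a\in A, b\in B\}$. $|A|$ denotes the cardinality of a finite set $A$. $R^*$ denotes the set of non-zero-divisors of $R$, i.e. the elements $r \in R$ such that $ra \neq 0$ and $ar \neq 0$ whenever $a \in R$, $a \neq 0$. -}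

module Defs where

open import Algebra.Bundles using (CommutativeRing; RingWithoutOne; Semiring)
import Algebra.Definitions.RawSemiring as RawSemiringDefs
open import Data.List.Base using (List; length)
import Data.List.Membership.Setoid as SetoidMembership
import Data.List.Relation.Unary.Unique.Setoid as SetoidUnique
open import Data.Nat.Base using (ℕ; _<_)
open import Data.Product.Base using (∃; ∃₂; _×_)
open import Function.Bundles using (_⇔_)
open import Level using (Level; _⊔_; Setω) renaming (suc to lsuc)
open import Relation.Binary.Core using (Rel)
open import Relation.Binary.Definitions using (_Respects_)
open import Relation.Binary.PropositionalEquality.Core using (_≡_)
open import Relation.Binary.Structures using (IsTotalOrder)
open import Relation.Nullary.Negation.Core using (¬_)
open import Relation.Unary using (Pred; _∈_)

-- "There is an absolute constant C > 0 such that P C".  P may quantify over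
-- structures of every universe level, so that C cannot depend on the level.
-- When P C is only weakened by enlarging C, it makes no difference whether
-- C ranges over the positive naturals or over the positive reals.
record ∃AbsoluteConstant (P : ℕ → Setω) : Setω where
  field
    C     : ℕ
    C>0   : 0 < C
    holds : P C

-- Ordered fields, of which ℝ is one: where a real parameter occurs, it is
-- taken in an arbitrary ordered field, the standard library having no ℝ.
record OrderedField (f ℓ₁ ℓ₂ : Level) : Set (lsuc (f ⊔ ℓ₁ ⊔ ℓ₂)) where
  infix 9 _⁻¹
  infix 4 _≤_
  field
    commutativeRing : CommutativeRing f ℓ₁

  open CommutativeRing commutativeRing public

  -- As usual for a total inverse, the value of 0# ⁻¹ is unspecified.
  field
    _⁻¹          : Carrier → Carrier
    ⁻¹-cong      : ∀ {x y} → x ≈ y → x ⁻¹ ≈ y ⁻¹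
    ⁻¹-inverseʳ  : ∀ x → ¬ (x ≈ 0#) → x * x ⁻¹ ≈ 1#
    0≉1          : ¬ (0# ≈ 1#)
    _≤_          : Rel Carrier ℓ₂
    isTotalOrder : IsTotalOrder _≈_ _≤_
    +-monoʳ-≤    : ∀ x {y z} → y ≤ z → x + y ≤ x + z
    *-nonNeg     : ∀ {x y} → 0# ≤ x → 0# ≤ y → 0# ≤ x * y

  open RawSemiringDefs (Semiring.rawSemiring semiring) public using (_^_)
  open RawSemiringDefs (Semiring.rawSemiring semiring) using () renaming (_×_ to _·_)

  fromℕ : ℕ → Carrier
  fromℕ n = n · 1#

module SubsetsOf {c ℓ : Level} (R : RingWithoutOne c ℓ) where
  open RingWithoutOne R
  open SetoidMembership setoid using () renaming (_∈_ to _∈ₗ_)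
  open SetoidUnique setoid using (Unique)

  infixl 6 _⊕_ _⊖_
  infixl 7 _⊙_
  infix  4 ∣_∣≡_

  _⊕_ _⊖_ _⊙_ : ∀ {p q} → Pred Carrier p → Pred Carrier q → Pred Carrier _
  (A ⊕ B) x = ∃₂ λ a b → a ∈ A × b ∈ B × x ≈ a + b
  (A ⊖ B) x = ∃₂ λ a b → a ∈ A × b ∈ B × x ≈ a - b
  (A ⊙ B) x = ∃₂ λ a b → a ∈ A × b ∈ B × x ≈ a * b

  -- P is finite with exactly n elements, elements being counted up to _≈_.
  -- The equivalence forces P to respect _≈_.
  ∣_∣≡_ : ∀ {p} → Pred Carrier p → ℕ → Set _
  ∣ P ∣≡ n = ∃ λ (xs : List Carrier) →
    Unique xs × (∀ x → x ∈ P ⇔ x ∈ₗ xs) × length xs ≡ n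

  -- R*, the set of non-zero-divisors (not the group of units).
  R* : Pred Carrier _
  R* r = ∀ a → ¬ (a ≈ 0#) → ¬ (r * a ≈ 0#) × ¬ (a * r ≈ 0#)

  record IsSubring {p} (S : Pred Carrier p) : Set (c ⊔ ℓ ⊔ p) where
    field
      resp     : S Respects _≈_
      0∈       : 0# ∈ S
      +-closed : ∀ {x y} → x ∈ S → y ∈ S → x + y ∈ S
      -‿closed : ∀ {x} → x ∈ S → - x ∈ S
      *-closed : ∀ {x y} → x ∈ S → y ∈ S → x * y ∈ S

{-# OPTIONS --safe #-}
module Submission where

-- Write B = A A.  Ruzsa's triangle inequality turns |A + B| ≤ K |A| and |B| ≥ |A| / K into |A - A| ≤ K³ |A|.
-- The set P of differences having ≥ |A| / 2K³ representations then has |P| ≥ |A| / 2, and each further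
-- summand P enlarges U - A by a factor of at most 2K⁶.  By Ruzsa's covering lemma H = P + P is an approximate
-- group such that polynomially many (in K) translates of H cover A, A A and H + H.
--
-- Let S consist of those x for which x A is covered by K^O(1) translates of H.  If x A is covered by M
-- translates and A - A has fewer than |A| / M zero divisors, then by pigeonhole x d = e for some d ∈ A - A in R*
-- and some e ∈ H + H, and this relation alone bounds the covering number of x A by a fixed power of K.  Hence the
-- losses incurred in adding and multiplying elements of S are recovered, and S is a ring.  Each x ∈ S
-- has ≫ |A| / K^O(1) such pairs (d, e), which determine it, so |S| ≤ K^O(1) |A|.

open import Defs
open import Algebra.Bundles using (RingWithoutOne)
open import Axiom.ExcludedMiddle using (ExcludedMiddle)
open import Data.Nat.Base using (ℕ)
open import Data.Product.Base using (∃; _×_; _,_)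
open import Data.Sum.Base using (_⊎_)
open import Level using (Level; _⊔_)
import Data.Sum.Base as Sum
open import Relation.Unary using (Pred; Satisfiable; _⊆_; _∖_)

-- Counting up to a relation by means of lists.

module Counting where
  open import Data.Empty using (⊥-elim)
  open import Data.List.Base using (List; []; _∷_; _++_; length; map; concatMap)
  import Data.List.Properties as List
  open import Data.List.Relation.Unary.All as All using (All; []; _∷_)
  import Data.List.Relation.Unary.All.Properties as All
  open import Data.List.Relation.Unary.AllPairs as AllPairs using (AllPairs; []; _∷_)
  import Data.List.Relation.Unary.AllPairs.Properties as AllPairs
  open import Data.List.Relation.Unary.Any as Any using (Any; here; there; _─_)
  import Data.List.Relation.Unary.Any.Properties as Any
  open import Data.Nat.Base using (zero; suc; _+_; _*_; _≤_; _<_; z≤n; s≤s)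
  open import Data.Nat.Properties using (≤-trans; ≤-reflexive; ≤-refl; <⇒≱; n≤1+n; +-mono-≤; *-monoˡ-≤; module ≤-Reasoning)
  open import Data.Product.Base using (proj₁; proj₂)
  open import Data.Product.Relation.Binary.Pointwise.NonDependent using (Pointwise)
  open import Data.Sum.Base using (inj₁; inj₂)
  open import Function.Base using (_∘_; id)
  open import Relation.Binary.Core using (Rel; REL)
  open import Relation.Binary.PropositionalEquality as ≡ using (_≡_; refl)
  open import Relation.Nullary.Decidable using (decidable-stable)
  open import Relation.Nullary using (¬_; yes; no; contradiction)
  open import Relation.Unary using (_∪_)

  private variable
    a b u v w r s t : Level
    X Y Z : Set a

  -- For R = _≈_ this says that U has at most n elements up to _≈_; for R y x = "x ∈ y + H" it says
  -- that n translates of H cover U.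
  AtMost : REL Y X r → Pred X u → ℕ → Set _
  AtMost R U n = ∃ λ ys → length ys ≤ n × (∀ {x} → U x → Any (λ y → R y x) ys)

  -- _~_ need not be symmetric: only the pairs (later, earlier) in the list are required to be unrelated.
  AtLeast : Rel X r → Pred X u → ℕ → Set _
  AtLeast _~_ U m = ∃ λ xs → AllPairs (λ x y → ¬ y ~ x) xs × All U xs × length xs ≡ m

  Any-─ : {P : Pred X u} {Q : Pred X v} {xs : List X} (p : Any P xs) → Any Q xs →
          (∀ {x} → P x → ¬ Q x) → Any Q (xs ─ p)
  Any-─ (here p)  (here q)  P⊥Q = ⊥-elim (P⊥Q p q)
  Any-─ (here p)  (there q) P⊥Q = q
  Any-─ (there p) (here q)  P⊥Q = here q
  Any-─ (there p) (there q) P⊥Q = there (Any-─ p q P⊥Q)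

  -- Each `x` uses up the `y` that covers it: no later `x′` is covered by the same `y`, so that `y`
  -- can be deleted from `ys`.
  pigeonhole : {_~_ : Rel X r} {U : Pred X u} {R : REL Y X s} {m n : ℕ} →
               AtLeast _~_ U m → AtMost R U n →
               (∀ {y x x′} → R y x → R y x′ → x′ ~ x) → m ≤ n
  pigeonhole {X = X} {Y = Y} {_~_ = _~_} {R = R} (xs , xs-distinct , xs∈U , refl) (ys , |ys|≤n , cover) R⇒~ =
    ≤-trans (go xs ys xs-distinct (All.map cover xs∈U)) |ys|≤n
    where
    go : ∀ (xs : List X) (ys : List Y) → AllPairs (λ x y → ¬ y ~ x) xs → All (λ x → Any (λ y → R y x) ys) xs →
         length xs ≤ length ys
    go []       ys _                   _           = z≤n
    go (x ∷ xs) ys (x≁xs ∷ xs-distinct) (p ∷ ps) = begin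
      suc (length xs)       ≤⟨ s≤s (go xs (ys ─ p) xs-distinct (remaining ps x≁xs)) ⟩
      suc (length (ys ─ p)) ≡⟨ List.length-removeAt′ ys (Any.index p) ⟨
      length ys             ∎
      where
      open ≤-Reasoning
      remaining : ∀ {zs} → All (λ z → Any (λ y → R y z) ys) zs → All (λ z → ¬ z ~ x) zs →
                  All (λ z → Any (λ y → R y z) (ys ─ p)) zs
      remaining []       []            = []
      remaining (q ∷ qs) (z≁x ∷ zs≁x) =
        Any-─ p q (λ Ryx Ryz → z≁x (R⇒~ Ryx Ryz)) ∷ remaining qs zs≁x

  AtMost-map : {R : REL Y X r} {U : Pred X u} {X′ : Set a} {Y′ : Set b} {S : REL Y′ X′ s} {V : Pred X′ v}
               {n : ℕ} (f : Y → Y′) →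
               (∀ {x′} → V x′ → ∃ λ x → U x × (∀ {y} → R y x → S (f y) x′)) →
               AtMost R U n → AtMost S V n
  AtMost-map f pull (ys , |ys|≤n , cover) =
    map f ys ,
    ≤-trans (≤-reflexive (List.length-map f ys)) |ys|≤n ,
    λ x′∈V → let x , x∈U , R⇒S = pull x′∈V in Any.map⁺ (Any.map R⇒S (cover x∈U))

  AtMost-⊆ : {R : REL Y X r} {U : Pred X u} {V : Pred X v} {n : ℕ} →
             V ⊆ U → AtMost R U n → AtMost R V n
  AtMost-⊆ V⊆U (ys , |ys|≤n , cover) = ys , |ys|≤n , λ x∈V → cover (V⊆U x∈V)

  AtMost-≤ : {R : REL Y X r} {U : Pred X u} {m n : ℕ} → m ≤ n → AtMost R U m → AtMost R U n
  AtMost-≤ m≤n (ys , |ys|≤m , cover) = ys , ≤-trans |ys|≤m m≤n , cover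

  AtMost-∪ : {R : REL Y X r} {U : Pred X u} {V : Pred X v} {m n : ℕ} →
             AtMost R U m → AtMost R V n → AtMost R (U ∪ V) (m + n)
  AtMost-∪ (ys , |ys|≤m , cover) (zs , |zs|≤n , cover′) =
    ys ++ zs ,
    ≤-trans (≤-reflexive (List.length-++ ys)) (+-mono-≤ |ys|≤m |zs|≤n) ,
    λ { (inj₁ x∈U) → Any.++⁺ˡ (cover x∈U) ; (inj₂ x∈V) → Any.++⁺ʳ ys (cover′ x∈V) }

  AtMost-refine : {R : REL Y X r} {S : REL Z X s} {U : Pred X u} {m n : ℕ} →
                  AtMost R U m → (∀ y → AtMost S (λ x → U x × R y x) n) → AtMost S U (m * n)
  AtMost-refine {Y = Y} {X = X} {Z = Z} {R = R} {S = S} {U = U} {n = n} (ys , |ys|≤m , cover) fibre =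
    concatMap zs ys , ≤-trans (length-concat ys) (*-monoˡ-≤ n |ys|≤m) ,
    λ x∈U → collect x∈U ys (cover x∈U)
    where
    zs : Y → List Z
    zs = proj₁ ∘ fibre

    length-concat : ∀ ys → length (concatMap zs ys) ≤ length ys * n
    length-concat []       = z≤n
    length-concat (y ∷ ys) =
      ≤-trans (≤-reflexive (List.length-++ (zs y)))
              (+-mono-≤ (proj₁ (proj₂ (fibre y))) (length-concat ys))

    collect : ∀ {x} → U x → ∀ ys → Any (λ y → R y x) ys → Any (λ z → S z x) (concatMap zs ys)
    collect x∈U (y ∷ ys) (here Ryx) = Any.++⁺ˡ (proj₂ (proj₂ (fibre y)) (x∈U , Ryx))
    collect x∈U (y ∷ ys) (there p)  = Any.++⁺ʳ (zs y) (collect x∈U ys p)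

  AtMost-× : {R : REL Y X r} {U : Pred X u} {X′ : Set a} {Y′ : Set b} {S : REL Y′ X′ s} {V : Pred X′ v}
             {m n : ℕ} → AtMost R U m → AtMost S V n →
             AtMost (Pointwise R S) (λ (x , x′) → U x × V x′) (m * n)
  AtMost-× {R = R} {S = S} U≤m V≤n =
    AtMost-refine {R = λ y (x , _) → R y x}
      (AtMost-map id (λ {(x , _)} (x∈U , _) → x , x∈U , id) U≤m)
      (λ y → AtMost-map (y ,_) (λ {(_ , x′)} ((_ , x′∈V) , Ryx) → x′ , x′∈V , (Ryx ,_)) V≤n)

  AtLeast-map : {_~_ : Rel X r} {U : Pred X u} {_≈_ : Rel Y s} {V : Pred Y v} {m : ℕ} (f : X → Y) →
                (∀ {x} → U x → V (f x)) → (∀ {x y} → f x ≈ f y → x ~ y) →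
                AtLeast _~_ U m → AtLeast _≈_ V m
  AtLeast-map f U⇒V f-injective (xs , xs-distinct , xs∈U , |xs|≡m) =
    map f xs ,
    AllPairs.map⁺ (AllPairs.map (λ y≁x → y≁x ∘ f-injective) xs-distinct) ,
    All.map⁺ (All.map U⇒V xs∈U) ,
    ≡.trans (List.length-map f xs) |xs|≡m

  -- The fibres are concatenated. Related values `y` come from related `x`, so elements of different
  -- fibres stay unrelated.
  AtLeast-∃ : {_~_ : Rel X r} {U : Pred X u} {_≈_ : Rel Y s} {R : REL X Y t} {m n : ℕ} →
              AtLeast _~_ U m → (∀ {x} → U x → AtLeast _≈_ (R x) n) →
              (∀ {x x′ y y′} → R x y → R x′ y′ → y′ ≈ y → x′ ~ x) →
              AtLeast _≈_ (λ y → ∃ λ x → U x × R x y) (m * n)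
  AtLeast-∃ {X = X} {Y = Y} {_~_ = _~_} {U = U} {_≈_ = _≈_} {R = R} {n = n}
            (xs , xs-distinct , xs∈U , refl) fibre R-functional =
    concatFibres xs∈U , distinct xs-distinct xs∈U , sound xs∈U , length-concat xs∈U
    where
    concatFibres : ∀ {xs} → All U xs → List Y
    concatFibres []       = []
    concatFibres (p ∷ ps) = proj₁ (fibre p) ++ concatFibres ps

    length-concat : ∀ {xs} (ps : All U xs) → length (concatFibres ps) ≡ length xs * n
    length-concat []       = refl
    length-concat (p ∷ ps) =
      ≡.trans (List.length-++ (proj₁ (fibre p)))
              (≡.cong₂ _+_ (proj₂ (proj₂ (proj₂ (fibre p)))) (length-concat ps))

    avoids : ∀ {x y xs} (ps : All U xs) → R x y → All (λ x′ → ¬ x′ ~ x) xs →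
             All (λ y′ → ¬ y′ ≈ y) (concatFibres ps)
    avoids []       Rxy []              = []
    avoids (p ∷ ps) Rxy (x′≁x ∷ xs≁x) =
      All.++⁺ (All.map (λ Rx′y′ y′≈y → x′≁x (R-functional Rxy Rx′y′ y′≈y)) (proj₁ (proj₂ (proj₂ (fibre p)))))
              (avoids ps Rxy xs≁x)

    distinct : ∀ {xs} → AllPairs (λ x y → ¬ y ~ x) xs → (ps : All U xs) →
               AllPairs (λ x y → ¬ y ≈ x) (concatFibres ps)
    distinct []           []       = []
    distinct (x≁xs ∷ rest) (p ∷ ps) =
      let ys , ys-distinct , Rxys , _ = fibre p in
      AllPairs.++⁺ ys-distinct (distinct rest ps) (All.map (λ Rxy → avoids ps Rxy x≁xs) Rxys)

    sound : ∀ {xs} (ps : All U xs) → All (λ y → ∃ λ x → U x × R x y) (concatFibres ps)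
    sound []             = []
    sound (_∷_ {x} p ps) =
      All.++⁺ (All.map (λ Rxy → x , p , Rxy) (proj₁ (proj₂ (proj₂ (fibre p))))) (sound ps)

  AtLeast-inhabited : {_~_ : Rel X r} {U : Pred X u} {m : ℕ} → 0 < m → AtLeast _~_ U m → ∃ U
  AtLeast-inhabited ()  ([]    , _ , []      , refl)
  AtLeast-inhabited 0<m (x ∷ _ , _ , x∈U ∷ _ , _) = x , x∈U

  -- Each `x` has `n` representations `y` in `V`, and a representation determines what it
  -- represents, so the representations found are pairwise distinct.
  double-counting : {_~_ : Rel X r} {U : Pred X u} {_≈_ : Rel Y s} {V : Pred Y v}
                    {_≈′_ : REL Z Y w} {R : REL X Y t} {m n k : ℕ} →
                    AtLeast _~_ U m → (∀ {x} → U x → AtLeast _≈_ (λ y → V y × R x y) n) →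
                    (∀ {x x′ y y′} → R x y → R x′ y′ → y′ ≈ y → x′ ~ x) →
                    AtMost _≈′_ V k → (∀ {z y y′} → z ≈′ y → z ≈′ y′ → y′ ≈ y) → m * n ≤ k
  double-counting m≤U fibre R-functional V≤k ≈′⇒≈ =
    pigeonhole
      (AtLeast-∃ m≤U fibre (λ (_ , Rxy) (_ , Rx′y′) → R-functional Rxy Rx′y′))
      (AtMost-⊆ (λ (_ , _ , y∈V , _) → y∈V) V≤k)
      ≈′⇒≈

  module _ (em : ∀ {e : Level} → ExcludedMiddle e) where

    -- A list of pairwise unrelated elements that cannot be extended covers `U`. For translates this
    -- is the maximal disjoint family behind Ruzsa's covering lemma.
    dichotomy : (_~_ : Rel X r) (U : Pred X u) (n : ℕ) → AtMost _~_ U n ⊎ AtLeast _~_ U (suc n)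
    dichotomy _~_ U zero with em {P = ∃ U}
    ... | yes (x , x∈U) = inj₂ (x ∷ [] , [] ∷ [] , x∈U ∷ [] , refl)
    ... | no  U-empty   = inj₁ ([] , z≤n , λ x∈U → ⊥-elim (U-empty (_ , x∈U)))
    dichotomy _~_ U (suc n) with dichotomy _~_ U n
    ... | inj₁ U≤n = inj₁ (AtMost-≤ (n≤1+n n) U≤n)
    ... | inj₂ (xs , xs-distinct , xs∈U , |xs|≡n) with em {P = ∃ λ x → U x × ¬ Any (_~ x) xs}
    ...   | yes (x , x∈U , x∉xs) =
            inj₂ (x ∷ xs , All.¬Any⇒All¬ xs x∉xs ∷ xs-distinct , x∈U ∷ xs∈U , ≡.cong suc |xs|≡n)
    ...   | no  complete =
            inj₁ (xs , ≤-reflexive |xs|≡n , λ {x} x∈U → decidable-stable em λ x∉xs → complete (x , x∈U , x∉xs))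

    atMost : (_~_ : Rel X r) (U : Pred X u) {n : ℕ} → (∀ m → AtLeast _~_ U m → m ≤ n) → AtMost _~_ U n
    atMost _~_ U {n} bound with dichotomy _~_ U n
    ... | inj₁ U≤n = U≤n
    ... | inj₂ n<U = contradiction (bound (suc n) n<U) (<⇒≱ ≤-refl)

module SumProduct where
  open Counting
  open import Algebra.Bundles using (AbelianGroup)
  import Algebra.Properties.CommutativeSemigroup as CommutativeSemigroupProperties
  import Algebra.Properties.CommutativeSemiring.Exp as Exp
  import Algebra.Properties.Ring as RingProperties
  import Algebra.Properties.RingWithoutOne as RingWithoutOneProperties
  import Algebra.Properties.Semiring.Mult as Mult
  open import Data.Empty using (⊥-elim)
  open import Data.List.Base using ([]; _∷_)
  import Data.List.Membership.Setoid as SetoidMembership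
  open import Data.List.Relation.Unary.All as All using ([]; _∷_)
  import Data.List.Relation.Unary.All.Properties as All
  open import Data.List.Relation.Unary.AllPairs as AllPairs using ([]; _∷_)
  open import Data.List.Relation.Unary.Any as Any using (Any)
  open import Data.Nat.Base using (zero; suc; _≤_; _<_; z≤n; s≤s; >-nonZero)
    renaming (_+_ to _+ℕ_; _*_ to _*ℕ_; _^_ to _^ℕ_; _⊔_ to _⊔ℕ_)
  open import Data.Nat.DivMod using (_/_; _%_; m/n*n≤m; m≡m%n+[m/n]*n; m%n<n)
  import Data.Nat.Properties as ℕ
  open import Data.Nat.Tactic.RingSolver using (solve-∀)
  open import Data.Product.Base using (proj₁; proj₂; uncurry)
  open import Data.Product.Relation.Binary.Pointwise.NonDependent using (Pointwise)
  open import Data.Sum.Base using (inj₁; inj₂)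
  open import Function.Base using (_∘_; id)
  open import Function.Bundles using (mk⇔; Equivalence)
  open import Relation.Binary.Bundles using (Poset)
  open import Relation.Binary.Core using (Rel; REL)
  open import Relation.Binary.Definitions using (_Respects_)
  open import Relation.Binary.PropositionalEquality as ≡ using (_≡_)
  import Relation.Binary.Reasoning.PartialOrder as PartialOrderReasoning
  open import Relation.Binary.Structures using (IsTotalOrder)
  open import Relation.Nullary.Decidable using (decidable-stable; True; toWitness)
  open import Relation.Nullary.Negation using (¬_; contradiction)
  open import Relation.Nullary using (yes; no)
  open import Relation.Unary using (_∪_; _∈_)

  -- Arithmetic of the averaging arguments.

  module _ where
    open ℕ.≤-Reasoning

    popular-pairs-bound : ∀ {N m k t} → 0 < N → 2 *ℕ k *ℕ t ≤ N → 2 *ℕ m < N → m *ℕ N +ℕ k *ℕ N *ℕ t < N *ℕ N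
    popular-pairs-bound {N} {m} {k} {t} 0<N 2kt≤N 2m<N = ℕ.*-cancelˡ-< 2 _ _ (begin-strict
      2 *ℕ (m *ℕ N +ℕ k *ℕ N *ℕ t)       ≡⟨ expand m N k t ⟩
      2 *ℕ m *ℕ N +ℕ 2 *ℕ k *ℕ t *ℕ N    <⟨ ℕ.+-mono-<-≤ (ℕ.*-monoˡ-< N {{>-nonZero 0<N}} 2m<N) (ℕ.*-monoˡ-≤ N 2kt≤N) ⟩
      N *ℕ N +ℕ N *ℕ N                   ≡⟨ ≡.cong (N *ℕ N +ℕ_) (ℕ.+-identityʳ (N *ℕ N)) ⟨
      2 *ℕ (N *ℕ N)                      ∎)
      where
      expand : ∀ m N k t → 2 *ℕ (m *ℕ N +ℕ k *ℕ N *ℕ t) ≡ 2 *ℕ m *ℕ N +ℕ 2 *ℕ k *ℕ t *ℕ N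
      expand = solve-∀

    -- Here `m` objects have `t` representations each, out of `y N` in all, and `t` is at least
    -- `N / c`.
    cancel-average : ∀ {N c t m y} → 0 < N → N ≤ c *ℕ t → m *ℕ t ≤ y *ℕ N → m ≤ c *ℕ y
    cancel-average {N} {c} {t} {m} {y} 0<N N≤ct mt≤yN = ℕ.*-cancelʳ-≤ m _ N {{>-nonZero 0<N}} (begin
      m *ℕ N           ≤⟨ ℕ.*-monoʳ-≤ m N≤ct ⟩
      m *ℕ (c *ℕ t)    ≡⟨ commute m c t ⟩
      c *ℕ (m *ℕ t)    ≤⟨ ℕ.*-monoʳ-≤ c mt≤yN ⟩
      c *ℕ (y *ℕ N)    ≡⟨ ℕ.*-assoc c y N ⟨
      c *ℕ y *ℕ N      ∎)
      where
      commute : ∀ m c t → m *ℕ (c *ℕ t) ≡ c *ℕ (m *ℕ t)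
      commute = solve-∀

    -- `q` is one less than `n / d` rounded up: a count of at most `q` can be refuted by the strict
    -- bound, and `suc q` is at least `n / d`.
    quotient : ∀ {d n} → 0 < d → 0 < n → ∃ λ q → d *ℕ q < n × n ≤ d *ℕ suc q
    quotient {d} {suc n} 0<d _ =
      -- The predecessor is divided, which makes the first bound strict even when the division is
      -- exact.
      n / d , s≤s (ℕ.≤-trans (ℕ.≤-reflexive (ℕ.*-comm d (n / d))) (m/n*n≤m n d)) , (begin-strict
        n                       ≡⟨ m≡m%n+[m/n]*n n d ⟩
        n % d +ℕ n / d *ℕ d     <⟨ ℕ.+-monoˡ-< (n / d *ℕ d) (m%n<n n d) ⟩
        suc (n / d) *ℕ d        ≡⟨ ℕ.*-comm (suc (n / d)) d ⟩
        d *ℕ suc (n / d)        ∎)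
      where instance _ = >-nonZero 0<d

    *-positive : ∀ {m n} → 0 < m → 0 < n → 0 < m *ℕ n
    *-positive {m} {n} = ℕ.*-mono-≤ {1} {m} {1} {n}

    *-≤-^ : ∀ r {x y} i j → x ≤ r ^ℕ i → y ≤ r ^ℕ j → x *ℕ y ≤ r ^ℕ (i +ℕ j)
    *-≤-^ r {x} {y} i j x≤ y≤ = begin
      x *ℕ y                ≤⟨ ℕ.*-mono-≤ x≤ y≤ ⟩
      r ^ℕ i *ℕ r ^ℕ j      ≡⟨ ℕ.^-distribˡ-+-* r i j ⟨
      r ^ℕ (i +ℕ j)         ∎

    -- The `z` zero divisors account for less than half of the count `N`, so the `g` denominators
    -- account for more than half.
    multiplier-count : ∀ {N z M g} → 2 *ℕ (M *ℕ z) < N → N ≤ M *ℕ (z +ℕ g) → N < 2 *ℕ M *ℕ g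
    multiplier-count {N} {z} {M} {g} 2Mz<N N≤M[z+g] = ℕ.+-cancelˡ-< N _ _ (begin-strict
      N +ℕ N                          ≡⟨ ≡.cong (N +ℕ_) (ℕ.+-identityʳ N) ⟨
      2 *ℕ N                          ≤⟨ ℕ.*-monoʳ-≤ 2 N≤M[z+g] ⟩
      2 *ℕ (M *ℕ (z +ℕ g))            ≡⟨ expand M z g ⟩
      2 *ℕ (M *ℕ z) +ℕ 2 *ℕ M *ℕ g    <⟨ ℕ.+-monoˡ-< (2 *ℕ M *ℕ g) 2Mz<N ⟩
      N +ℕ 2 *ℕ M *ℕ g                ∎)
      where
      expand : ∀ M z g → 2 *ℕ (M *ℕ (z +ℕ g)) ≡ 2 *ℕ (M *ℕ z) +ℕ 2 *ℕ M *ℕ g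
      expand = solve-∀

  -- Coverings by translates, and Ruzsa's inequalities.

  module Sumsets (em : ∀ {e : Level} → ExcludedMiddle e) {c ℓ : Level} (R : RingWithoutOne c ℓ) where
    open RingWithoutOne R renaming (refl to ≈-refl; sym to ≈-sym; trans to ≈-trans; reflexive to ≈-reflexive)
    open RingWithoutOneProperties R
    open CommutativeSemigroupProperties (AbelianGroup.commutativeSemigroup +-abelianGroup)
      using () renaming (interchange to +-interchange)
    open SubsetsOf R
    open import Relation.Binary.Reasoning.Setoid setoid

    infix 4 _≼[_]_
    infixr 7 _◂_

    -- This level is closed under `⊕`, `⊖`, `⊙` and `◂`, and sets defined by covering numbers stay
    -- in it.
    Subset : Set _
    Subset = Pred Carrier (c ⊔ ℓ)

    private variable
      U U′ V V′ W : Subset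
      m n : ℕ

    _◂_ : Carrier → Subset → Subset
    (x ◂ U) y = ∃ λ u → u ∈ U × y ≈ x * u

    Translate : Subset → Rel Carrier _
    Translate V x y = ∃ λ v → v ∈ V × y ≈ x + v

    _≼[_]_ : Subset → ℕ → Subset → Set _
    U ≼[ n ] V = AtMost (Translate V) U n

    same : ∀ {x y z : Carrier} → x ≈ y → x ≈ z → z ≈ y
    same x≈y x≈z = ≈-trans (≈-sym x≈z) x≈y

    same₂ : ∀ {x y z : Carrier × Carrier} → Pointwise _≈_ _≈_ x y → Pointwise _≈_ _≈_ x z → Pointwise _≈_ _≈_ z y
    same₂ (p , p′) (q , q′) = same p q , same p′ q′

    -‿interchange : ∀ x y z w → (x + y) - (z + w) ≈ (x - z) + (y - w)
    -‿interchange x y z w = begin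
      (x + y) - (z + w)     ≈⟨ +-congˡ (-‿+-comm z w) ⟨
      (x + y) + (- z - w)   ≈⟨ +-interchange x y (- z) (- w) ⟩
      (x - z) + (y - w)     ∎

    [x-y]+y≈x : ∀ x y → (x - y) + y ≈ x
    [x-y]+y≈x x y = //-rightDividesˡ y x

    x+[y-x]≈y : ∀ x y → x + (y - x) ≈ y
    x+[y-x]≈y x y = ≈-trans (+-comm x (y - x)) ([x-y]+y≈x y x)

    telescope : ∀ x y z → (x - y) + (y + z) ≈ x + z
    telescope x y z = ≈-trans (+-assoc x (- y) (y + z)) (+-congˡ (\\-leftDividesʳ y z))

    ≼-trans : U ≼[ m ] V → V ≼[ n ] W → U ≼[ m *ℕ n ] W
    ≼-trans U≼V V≼W =
      AtMost-refine U≼V λ x → AtMost-map (x +_)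
        (λ (_ , v , v∈V , u≈x+v) → v , v∈V , λ {y} (w , w∈W , v≈y+w) →
          w , w∈W , ≈-trans u≈x+v (≈-trans (+-congˡ v≈y+w) (≈-sym (+-assoc x y w))))
        V≼W

    ≼-⊕ : U ≼[ m ] V → U′ ≼[ n ] V′ → U ⊕ U′ ≼[ m *ℕ n ] V ⊕ V′
    ≼-⊕ U≼V U′≼V′ =
      AtMost-map (uncurry _+_)
        (λ (u , u′ , u∈U , u′∈U′ , x≈u+u′) → (u , u′) , (u∈U , u′∈U′) ,
          λ ((v , v∈V , u≈y+v) , (v′ , v′∈V′ , u′≈y′+v′)) →
            v + v′ , (v , v′ , v∈V , v′∈V′ , ≈-refl) ,
            ≈-trans x≈u+u′ (≈-trans (+-cong u≈y+v u′≈y′+v′) (+-interchange _ v _ v′)))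
        (AtMost-× U≼V U′≼V′)

    ≼-⊖ : U ≼[ m ] V → U′ ≼[ n ] V′ → U ⊖ U′ ≼[ m *ℕ n ] V ⊖ V′
    ≼-⊖ U≼V U′≼V′ =
      AtMost-map (uncurry _-_)
        (λ (u , u′ , u∈U , u′∈U′ , x≈u-u′) → (u , u′) , (u∈U , u′∈U′) ,
          λ ((v , v∈V , u≈y+v) , (v′ , v′∈V′ , u′≈y′+v′)) →
            v - v′ , (v , v′ , v∈V , v′∈V′ , ≈-refl) ,
            ≈-trans x≈u-u′ (≈-trans (+-cong u≈y+v (-‿cong u′≈y′+v′)) (-‿interchange _ v _ v′)))
        (AtMost-× U≼V U′≼V′)

    ≼-◂ : ∀ x → U ≼[ n ] V → x ◂ U ≼[ n ] x ◂ V
    ≼-◂ x =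
      AtMost-map (x *_) λ (u , u∈U , y≈xu) → u , u∈U , λ (v , v∈V , u≈z+v) →
        x * v , (v , v∈V , ≈-refl) , ≈-trans y≈xu (≈-trans (*-congˡ u≈z+v) (distribˡ x _ v))

    ≼-⊆ʳ : V ⊆ W → U ≼[ n ] V → U ≼[ n ] W
    ≼-⊆ʳ V⊆W = AtMost-map id λ u∈U → _ , u∈U , λ (v , v∈V , eq) → v , V⊆W v∈V , eq

    ≼-finite : U ≼[ m ] V → AtMost _≈_ V n → AtMost _≈_ U (m *ℕ n)
    ≼-finite U≼V V≤n =
      AtMost-refine U≼V λ x → AtMost-map (x +_)
        (λ (_ , v , v∈V , u≈x+v) → v , v∈V , λ y≈v → ≈-trans (+-congˡ y≈v) (≈-sym u≈x+v))
        V≤n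

    -- Elements of `U` unrelated modulo `V ⊖ V` have disjoint translates of `V` inside `U ⊕ V`, so
    -- `n + 1` of them would give `(n + 1) v` elements.
    Ruzsa-covering : ∀ {v} → 0 < v → AtLeast _≈_ V v → AtMost _≈_ (U ⊕ V) (n *ℕ v) → U ≼[ n ] V ⊖ V
    Ruzsa-covering {V} {U} {n} {v} 0<v v≤V U+V≤nv with dichotomy em (Translate (V ⊖ V)) U n
    ... | inj₁ U≼V-V = U≼V-V
    ... | inj₂ n<U   = contradiction [1+n]v≤nv (ℕ.<⇒≱ (ℕ.m<n+m (n *ℕ v) 0<v))
      where
      [1+n]v≤nv : suc n *ℕ v ≤ n *ℕ v
      [1+n]v≤nv = double-counting {_≈_ = _≈_} {R = Translate V} n<U
        (λ {x} x∈U → AtLeast-map (x +_)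
          (λ {v} v∈V → (x , v , x∈U , v∈V , ≈-refl) , (v , v∈V , ≈-refl)) (+-cancelˡ x _ _) v≤V)
        (λ {x} {x′} {y} {y′} (v , v∈V , y≈x+v) (v′ , v′∈V , y′≈x′+v′) y′≈y →
          v′ - v , (v′ , v , v′∈V , v∈V , ≈-refl) , (begin
            x             ≈⟨ //-rightDividesʳ v x ⟨
            (x + v) - v   ≈⟨ +-congʳ y≈x+v ⟨
            y - v         ≈⟨ +-congʳ y′≈y ⟨
            y′ - v        ≈⟨ +-congʳ y′≈x′+v′ ⟩
            (x′ + v′) - v ≈⟨ +-assoc x′ v′ (- v) ⟩
            x′ + (v′ - v) ∎))
        U+V≤nv same

    -- A difference `u - u′` equals `(u + v) - (u′ + v)` for every `v` in `V`, hence has `b`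
    -- representations by pairs from `U ⊕ V`.
    Ruzsa-triangle : ∀ {b} → AtLeast _≈_ V b → AtMost _≈_ (U ⊕ V) n →
                     ∀ m → AtLeast _≈_ (U ⊖ U) m → m *ℕ b ≤ n *ℕ n
    Ruzsa-triangle b≤V U+V≤n m m≤U-U =
      double-counting {_≈_ = Pointwise _≈_ _≈_} {R = λ z (s , s′) → z ≈ s - s′} m≤U-U
        (λ (u , u′ , u∈U , u′∈U , z≈u-u′) → AtLeast-map (λ v → u + v , u′ + v)
          (λ {v} v∈V → ((u , v , u∈U , v∈V , ≈-refl) , (u′ , v , u′∈U , v∈V , ≈-refl)) ,
            ≈-trans z≈u-u′ (begin
              u - u′                   ≈⟨ +-congʳ (//-rightDividesʳ v u) ⟨
              ((u + v) - v) - u′       ≈⟨ +-assoc (u + v) (- v) (- u′) ⟩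
              (u + v) + (- v - u′)     ≈⟨ +-congˡ (-‿anti-homo-+ u′ v) ⟨
              (u + v) - (u′ + v)       ∎))
          (λ (p , _) → +-cancelˡ u _ _ p)
          b≤V)
        (λ z≈ z′≈ (p , p′) → ≈-trans z′≈ (≈-trans (+-cong p (-‿cong p′)) (≈-sym z≈)))
        (AtMost-× U+V≤n U+V≤n) same₂

    -- H stands in for an approximate subgroup commensurable with A.
    record Controls (H A : Subset) (N κ : ℕ) : Set (c ⊔ ℓ) where
      field
        -‿closed : ∀ {x} → x ∈ H → - x ∈ H
        H⊆4A     : H ⊆ (A ⊖ A) ⊕ (A ⊖ A)
        H+H≼H    : H ⊕ H ≼[ κ ] H
        A≼H      : A ≼[ κ ] H
        AA≼H     : A ⊙ A ≼[ κ ] H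
        |H|≤κN   : AtMost _≈_ H (κ *ℕ N)

    -- Popular differences, and the approximate group built from them.

    Popular : Subset → ℕ → Subset
    Popular A t d = AtLeast _≈_ (λ x → x ∈ A × x + d ∈ A) t

    module _ {A : Subset} (A-resp : A Respects _≈_) {N : ℕ} (0<N : 0 < N)
             (A≥N : AtLeast _≈_ A N) (A≤N : AtMost _≈_ A N) where

      Popular-resp : ∀ {t} → Popular A t Respects _≈_
      Popular-resp d≈e = AtLeast-map id (λ (x∈A , x+d∈A) → x∈A , A-resp (+-congˡ d≈e) x+d∈A) id

      -- The shift by `d` carries the representations of `d` to those of `- d`. This is what makes H
      -- = P + P symmetric.
      Popular-neg : ∀ {t d} → Popular A t d → Popular A t (- d)
      Popular-neg {d = d} = AtLeast-map (_+ d)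
        (λ {x} (x∈A , x+d∈A) → x+d∈A , A-resp (≈-sym (//-rightDividesʳ d x)) x∈A) (+-cancelʳ d _ _)

      Popular⊆A⊖A : ∀ {t} → Popular A (suc t) ⊆ A ⊖ A
      Popular⊆A⊖A {x = d} (x ∷ _ , _ , (x∈A , x+d∈A) ∷ _ , _) = x + d , x , x+d∈A , x∈A , ≈-sym (xyx⁻¹≈y x d)

      -- With at most `m` popular differences, the N² pairs in A could not all be accounted for: a
      -- popular difference has at most `N` representations, an unpopular one at most `t`, and there
      -- are at most `k N` differences.
      popular-many : ∀ {k t m} → AtMost _≈_ (A ⊖ A) (k *ℕ N) → 2 *ℕ k *ℕ t ≤ N → 2 *ℕ m < N →
                     AtLeast _≈_ (Popular A (suc t)) (suc m)
      popular-many {k} {t} {m} A-A≤kN 2kt≤N 2m<N with dichotomy em _≈_ (Popular A (suc t)) m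
      ... | inj₂ m<P = m<P
      ... | inj₁ P≤m = contradiction N²≤ (ℕ.<⇒≱ (popular-pairs-bound {m = m} {k} {t} 0<N 2kt≤N 2m<N))
        where
        Pairs : Pred (Carrier × Carrier) _
        Pairs (x , y) = x ∈ A × y ∈ A

        pairs≥ : AtLeast (Pointwise _≈_ _≈_) (λ p → ∃ λ x → x ∈ A × (x ≈ proj₁ p × proj₂ p ∈ A)) (N *ℕ N)
        pairs≥ = AtLeast-∃ A≥N (λ {x} x∈A → AtLeast-map (x ,_) (λ y∈A → ≈-refl , y∈A) proj₂ A≥N)
          (λ (x≈ , _) (x′≈ , _) (p , _) → ≈-trans x′≈ (≈-trans p (≈-sym x≈)))

        Difference : REL Carrier (Carrier × Carrier) _
        Difference d (x , y) = d ≈ y - x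

        from-first : ∀ {d x y} → d ≈ y - x → ∀ {z} → z ≈ x → Pointwise _≈_ _≈_ (z , z + d) (x , y)
        from-first {d} {x} {y} d≈y-x {z} z≈x = z≈x , ≈-trans (+-cong z≈x d≈y-x) (x+[y-x]≈y x y)

        popular≤ : AtMost (Pointwise _≈_ _≈_) (λ (x , y) → Pairs (x , y) × Popular A (suc t) (y - x)) (m *ℕ N)
        popular≤ = AtMost-refine {R = Difference}
          (AtMost-map id (λ (_ , pop) → _ , pop , id) P≤m)
          (λ d → AtMost-map (λ x → x , x + d) (λ (((x∈A , _) , _) , d≈y-x) → _ , x∈A , from-first d≈y-x) A≤N)

        unpopular≤ : AtMost (Pointwise _≈_ _≈_) (λ (x , y) → Pairs (x , y) × ¬ Popular A (suc t) (y - x)) (k *ℕ N *ℕ t)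
        unpopular≤ = AtMost-refine {R = Difference}
          (AtMost-map id (λ ((x∈A , y∈A) , _) → _ , (_ , _ , y∈A , x∈A , ≈-refl) , id) A-A≤kN)
          fibre
          where
          fibre : ∀ d → AtMost (Pointwise _≈_ _≈_)
                          (λ (x , y) → (Pairs (x , y) × ¬ Popular A (suc t) (y - x)) × d ≈ y - x) t
          fibre d with dichotomy em _≈_ (λ x → x ∈ A × x + d ∈ A) t
          ... | inj₁ few  = AtMost-map (λ x → x , x + d)
            (λ {(x , y)} (((x∈A , y∈A) , _) , d≈y-x) →
              x , (x∈A , A-resp (≈-sym (≈-trans (+-congˡ d≈y-x) (x+[y-x]≈y x y))) y∈A) , from-first d≈y-x) few
          -- A popular `d` is the difference of no unpopular pair, so this fibre is empty.
          ... | inj₂ many = [] , z≤n , λ ((_ , unpopular) , d≈y-x) → ⊥-elim (unpopular (Popular-resp d≈y-x many))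

        N²≤ : N *ℕ N ≤ m *ℕ N +ℕ k *ℕ N *ℕ t
        N²≤ = pigeonhole pairs≥
          (AtMost-⊆ (λ {(x , y)} (_ , x′∈A , x′≈x , y∈A) → split (A-resp x′≈x x′∈A , y∈A))
            (AtMost-∪ popular≤ unpopular≤))
          same₂
          where
          split : ∀ {x y} → Pairs (x , y) →
                  (Pairs (x , y) × Popular A (suc t) (y - x)) ⊎ (Pairs (x , y) × ¬ Popular A (suc t) (y - x))
          split {x} {y} p with em {P = Popular A (suc t) (y - x)}
          ... | yes pop = inj₁ (p , pop)
          ... | no ¬pop = inj₂ (p , ¬pop)

      -- Every u + p - b can be rewritten in t ways as (u - x) + ((x + p) - b), with x and x + p in A.
      ⊕-Popular : ∀ {u n k t} {U : Pred Carrier u} → AtMost _≈_ (A ⊖ A) (k *ℕ N) → N ≤ 2 *ℕ k *ℕ t →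
                  AtMost _≈_ (U ⊖ A) n → AtMost _≈_ ((U ⊕ Popular A t) ⊖ A) (2 *ℕ k *ℕ k *ℕ n)
      ⊕-Popular {n = n} {k} {t} {U} A-A≤kN N≤2kt U-A≤n = atMost em _≈_ _ λ m m≤U+P-A →
        ℕ.≤-trans
          (cancel-average {c = 2 *ℕ k} {t} {m} {n *ℕ k} 0<N N≤2kt
            (ℕ.≤-trans (mt≤ m m≤U+P-A) (ℕ.≤-reflexive (≡.sym (ℕ.*-assoc n k N)))))
          (ℕ.≤-reflexive (regroup k n))
        where
        regroup : ∀ k n → 2 *ℕ k *ℕ (n *ℕ k) ≡ 2 *ℕ k *ℕ k *ℕ n
        regroup = solve-∀

        mt≤ : ∀ m → AtLeast _≈_ ((U ⊕ Popular A t) ⊖ A) m → m *ℕ t ≤ n *ℕ (k *ℕ N)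
        mt≤ m m≤U+P-A = double-counting {_≈_ = Pointwise _≈_ _≈_} {R = λ z (s , s′) → z ≈ s + s′} m≤U+P-A
          (λ {z} (w , b , (u , p , u∈U , p-popular , w≈u+p) , b∈A , z≈w-b) →
            AtLeast-map (λ x → u - x , (x + p) - b)
              (λ {x} (x∈A , x+p∈A) →
                ((u , x , u∈U , x∈A , ≈-refl) , (x + p , b , x+p∈A , b∈A , ≈-refl)) , (begin
                  z                           ≈⟨ z≈w-b ⟩
                  w - b                       ≈⟨ +-congʳ w≈u+p ⟩
                  (u + p) - b                 ≈⟨ +-assoc u p (- b) ⟩
                  u + (p - b)                 ≈⟨ telescope u x (p - b) ⟨
                  (u - x) + (x + (p - b))     ≈⟨ +-congˡ (+-assoc x p (- b)) ⟨
                  (u - x) + ((x + p) - b)     ∎))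
              (λ (q , _) → -‿injective (+-cancelˡ u _ _ q))
              p-popular)
          (λ z≈ z′≈ (p , p′) → ≈-trans z′≈ (≈-trans (+-cong p p′) (≈-sym z≈)))
          (AtMost-× U-A≤n A-A≤kN) same₂

      -- By the covering lemma, a bound on |X + P| covers X by translates of P - P, which lies in H
      -- = P + P as P is symmetric. Such bounds come from adding copies of P to P - A one at a time.
      -- The exponent 53 is that of the longest chain, from A A through A - A and H + H to H.
      controlled : ∀ {K b} → 0 < K → AtLeast _≈_ (A ⊙ A) b → N ≤ K *ℕ b →
                   AtMost _≈_ (A ⊕ A ⊙ A) (K *ℕ N) → ∃ λ H → Controls H A N ((2 *ℕ K) ^ℕ 53)
      controlled {K} 0<K b≤AA N≤Kb A+AA≤KN
        -- P will have at least `suc m` elements, and `suc t`, at least N / 2K³, is the popularity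
        -- threshold.
        with quotient {2} {N} (s≤s z≤n) 0<N
           | quotient {2 *ℕ (K *ℕ K *ℕ K)} {N} (*-positive {2} (s≤s z≤n) (*-positive (*-positive 0<K 0<K) 0<K)) 0<N
      ... | m , 2m<N , N≤2[1+m] | t , 2kt<N , N≤2k[1+t] = H , record
        { -‿closed = λ (p , p′ , p∈P , p′∈P , x≈) → - p , - p′ , P-neg p∈P , P-neg p′∈P ,
            ≈-trans (-‿cong x≈) (≈-sym (-‿+-comm p p′))
        ; H⊆4A     = λ (p , p′ , p∈P , p′∈P , x≈) → p , p′ , P⊆A-A p∈P , P⊆A-A p′∈P , x≈
        ; H+H≼H    = AtMost-≤ (≤κ 36 q⁵2≤) H+H≼H
        ; A≼H      = AtMost-≤ (≤κ 8 2q≤) A≼H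
        ; AA≼H     = AtMost-≤ AA≤ (≼-trans AA≼A-A (≼-trans A-A≼H+H H+H≼H))
        ; |H|≤κN   = AtMost-≤ (ℕ.*-monoˡ-≤ N (≤κ 14 q²≤)) |H|≤
        }
        where
        -- |A - A| is at most `k N`, each summand P costs a factor `q`, and `q⁵` pays for the five
        -- summands P in H + H + P.
        k = K *ℕ K *ℕ K
        q = 2 *ℕ k *ℕ k
        q⁵ = q *ℕ (q *ℕ (q *ℕ (q *ℕ q)))
        -- 2 and K are both at most r, so counting factors bounds every constant by a power of r.
        r = 2 *ℕ K

        P H : Subset
        P = Popular A (suc t)
        H = P ⊕ P

        K≤ : K ≤ r ^ℕ 1
        K≤ = ℕ.≤-trans (ℕ.m≤m+n K (1 *ℕ K)) (ℕ.≤-reflexive (≡.sym (ℕ.*-identityʳ r)))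

        2≤ : 2 ≤ r ^ℕ 1
        2≤ = ℕ.≤-trans (ℕ.*-monoʳ-≤ 2 0<K) (ℕ.≤-reflexive (≡.sym (ℕ.*-identityʳ r)))

        k≤ : k ≤ r ^ℕ 3
        k≤ = *-≤-^ r 2 1 (*-≤-^ r 1 1 K≤ K≤) K≤

        q≤ : q ≤ r ^ℕ 7
        q≤ = *-≤-^ r 4 3 (*-≤-^ r 1 3 2≤ k≤) k≤

        q²≤ : q *ℕ q ≤ r ^ℕ 14
        q²≤ = *-≤-^ r 7 7 q≤ q≤

        2q≤ : q *ℕ 2 ≤ r ^ℕ 8
        2q≤ = *-≤-^ r 7 1 q≤ 2≤

        q⁵2≤ : q⁵ *ℕ 2 ≤ r ^ℕ 36
        q⁵2≤ = *-≤-^ r 35 1 (*-≤-^ r 7 28 q≤ (*-≤-^ r 7 21 q≤ (*-≤-^ r 7 14 q≤ q²≤))) 2≤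

        AA≤ : K *ℕ (q *ℕ 2 *ℕ (q *ℕ 2) *ℕ (q⁵ *ℕ 2)) ≤ r ^ℕ 53
        AA≤ = *-≤-^ r 1 52 K≤ (*-≤-^ r 16 36 (*-≤-^ r 8 8 2q≤ 2q≤) q⁵2≤)

        ≤κ : ∀ i {i≤53 : True (i ℕ.≤? 53)} {x} → x ≤ r ^ℕ i → x ≤ r ^ℕ 53
        ≤κ i {i≤53} x≤ = ℕ.≤-trans x≤ (ℕ.^-monoʳ-≤ r {{>-nonZero (ℕ.≤-trans 0<K (ℕ.m≤m+n K _))}} (toWitness i≤53))

        P-neg : ∀ {d} → d ∈ P → - d ∈ P
        P-neg {d} = Popular-neg {suc t} {d}

        P⊆A-A : P ⊆ A ⊖ A
        P⊆A-A {d} = Popular⊆A⊖A {t} {d}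

        -- The triangle inequality bounds |A - A| `b` by (K N)², and `b` is at least N / K.
        A-A≤ : AtMost _≈_ (A ⊖ A) (k *ℕ N)
        A-A≤ = atMost em _≈_ _ λ m m≤A-A → ℕ.≤-trans
          (cancel-average {c = K} {m = m} 0<N N≤Kb
            (ℕ.≤-trans (Ruzsa-triangle b≤AA A+AA≤KN m m≤A-A) (ℕ.≤-reflexive (≡.sym (ℕ.*-assoc (K *ℕ N) K N)))))
          (ℕ.≤-reflexive (regroup K N))
          where
          regroup : ∀ K N → K *ℕ (K *ℕ N *ℕ K) ≡ K *ℕ K *ℕ K *ℕ N
          regroup = solve-∀

        P≥ : AtLeast _≈_ P (suc m)
        P≥ = popular-many {k} {t} {m} A-A≤ (ℕ.<⇒≤ 2kt<N) 2m<N

        +P : ∀ {u n} {U : Pred Carrier u} → AtMost _≈_ (U ⊖ A) n → AtMost _≈_ ((U ⊕ P) ⊖ A) (q *ℕ n)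
        +P = ⊕-Popular {k = k} A-A≤ N≤2k[1+t]

        P-A≤ : AtMost _≈_ (P ⊖ A) (q *ℕ N)
        P-A≤ = AtMost-⊆
          (λ (p , a , p∈P , a∈A , x≈) → p , a , (0# , p , ≈-refl , p∈P , ≈-sym (+-identityˡ p)) , a∈A , x≈)
          -- Start with the singleton of 0 as `U`: then `U ⊖ A` consists of the negatives of A, at
          -- most `N` in number.
          (+P (AtMost-map {V = (_≈ 0#) ⊖ A} (λ a → - a)
            (λ (z , a , z≈0 , a∈A , x≈) → a , a∈A , λ y≈a →
              ≈-trans (-‿cong y≈a) (≈-sym (≈-trans x≈ (≈-trans (+-congʳ z≈0) (+-identityˡ (- a))))))
            A≤N))

        -- Subtracting one fixed element of A injects `U` into `U ⊖ A`.
        untranslate : ∀ {U : Subset} {n} → AtMost _≈_ (U ⊖ A) n → AtMost _≈_ U n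
        untranslate U-A≤n = let a , a∈A = AtLeast-inhabited 0<N A≥N in
          AtMost-map (_+ a) (λ {x} x∈U → x - a , (x , a , x∈U , a∈A , ≈-refl) ,
            λ y≈x-a → ≈-trans (+-congʳ y≈x-a) ([x-y]+y≈x x a)) U-A≤n

        |H|≤ : AtMost _≈_ H (q *ℕ q *ℕ N)
        |H|≤ = AtMost-≤ (ℕ.≤-reflexive (≡.sym (ℕ.*-assoc q q N))) (untranslate (+P P-A≤))

        P-P⊆H : P ⊖ P ⊆ H
        P-P⊆H (p , p′ , p∈P , p′∈P , x≈) = p , - p′ , p∈P , P-neg p′∈P , x≈

        -- P is only known to have `suc m` elements, at least N / 2; restating bounds in terms of
        -- `suc m` costs the factor 2.
        scale : ∀ x → x *ℕ N ≤ x *ℕ 2 *ℕ suc m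
        scale x = ℕ.≤-trans (ℕ.*-monoʳ-≤ x N≤2[1+m]) (ℕ.≤-reflexive (≡.sym (ℕ.*-assoc x 2 (suc m))))

        -- The sum is reassociated so that copies of P are added one at a time, as `+P` does.
        H+H+P≤ : AtMost _≈_ ((H ⊕ H) ⊕ P) (q⁵ *ℕ N)
        H+H+P≤ = AtMost-≤ (ℕ.≤-reflexive (regroup q N)) (AtMost-⊆
          (λ (h , p₅ , (h₁ , h₂ , h₁∈H , (p₃ , p₄ , p₃∈P , p₄∈P , h₂≈) , h≈) , p₅∈P , x≈) →
            h₁ + p₃ + p₄ , p₅ , (h₁ + p₃ , p₄ , (h₁ , p₃ , h₁∈H , p₃∈P , ≈-refl) , p₄∈P , ≈-refl) , p₅∈P ,
            ≈-trans x≈ (+-congʳ (≈-trans h≈ (≈-trans (+-congˡ h₂≈) (≈-sym (+-assoc h₁ p₃ p₄))))))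
          (untranslate (+P (+P (+P (+P P-A≤))))))
          where
          regroup : ∀ q N → q *ℕ (q *ℕ (q *ℕ (q *ℕ (q *ℕ N)))) ≡ q *ℕ (q *ℕ (q *ℕ (q *ℕ q))) *ℕ N
          regroup = solve-∀

        H+H≼H : H ⊕ H ≼[ q⁵ *ℕ 2 ] H
        H+H≼H = ≼-⊆ʳ P-P⊆H (Ruzsa-covering (s≤s z≤n) P≥ (AtMost-≤ (scale q⁵) H+H+P≤))

        A≼H : A ≼[ q *ℕ 2 ] H
        -- As P is symmetric, A + P is the negative of P - A.
        A≼H = ≼-⊆ʳ P-P⊆H (Ruzsa-covering (s≤s z≤n) P≥ (AtMost-≤ (scale q) (AtMost-map (λ x → - x)
          (λ (a , p , a∈A , p∈P , x≈) → - p - a , (- p , a , P-neg p∈P , a∈A , ≈-refl) , λ y≈ →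
            ≈-trans (-‿cong y≈) (≈-trans (-‿cong (≈-sym (-‿anti-homo-+ a p))) (≈-trans (-‿involutive (a + p)) (≈-sym x≈))))
          P-A≤)))

        AA≼A-A : A ⊙ A ≼[ K ] A ⊖ A
        AA≼A-A = Ruzsa-covering 0<N A≥N
          (AtMost-⊆ (λ (b , a , b∈AA , a∈A , x≈) → a , b , a∈A , b∈AA , ≈-trans x≈ (+-comm b a)) A+AA≤KN)

        A-A≼H+H : A ⊖ A ≼[ q *ℕ 2 *ℕ (q *ℕ 2) ] H ⊕ H
        A-A≼H+H = ≼-⊆ʳ
          (λ (h , h′ , h∈H , (p , p′ , p∈P , p′∈P , h′≈) , x≈) → h , - h′ , h∈H ,
            (- p , - p′ , P-neg p∈P , P-neg p′∈P , ≈-trans (-‿cong h′≈) (≈-sym (-‿+-comm p p′))) , x≈)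
          (≼-⊖ A≼H A≼H)

  -- The subring of multipliers.

  module Multipliers (em : ∀ {e : Level} → ExcludedMiddle e) {c ℓ : Level} (R : RingWithoutOne c ℓ) where
    open RingWithoutOne R renaming (refl to ≈-refl; sym to ≈-sym; trans to ≈-trans; reflexive to ≈-reflexive)
    open RingWithoutOneProperties R
    open SubsetsOf R
    open Sumsets em R
    open import Relation.Binary.Reasoning.Setoid setoid

    module Construction {A H : Subset} (A-resp : A Respects _≈_) {N κ z : ℕ} (0<N : 0 < N) (0<κ : 0 < κ)
             (A≥N : AtLeast _≈_ A N) (A≤N : AtMost _≈_ A N) (controls : Controls H A N κ)
             (zeroDivisors≤z : AtMost _≈_ (λ d → d ∈ A ⊖ A × ¬ R* d) z)
             (2κ¹⁸⁸z<N : 2 *ℕ (κ ^ℕ 188 *ℕ z) < N) where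

      open Controls controls

      private variable
        U V : Subset
        x y d e : Carrier
        i j : ℕ

      -- The exponents below only record how often H+H≼H and its companions are used: quotient∈S costs 37
      -- whatever covering of x A one started from, and 188 is the most that a ring operation on S can cost.
      Small : ℕ → Subset → Set _
      Small i U = U ≼[ κ ^ℕ i ] H

      S : Subset
      S x = Small 37 (x ◂ A)

      κ^-mono : ∀ i j {i≤j : True (i ℕ.≤? j)} → κ ^ℕ i ≤ κ ^ℕ j
      κ^-mono i j {i≤j} = ℕ.^-monoʳ-≤ κ {{>-nonZero 0<κ}} (toWitness i≤j)

      ≼⇒Small : U ≼[ κ ] H → Small 1 U
      ≼⇒Small = AtMost-≤ (ℕ.≤-reflexive (≡.sym (ℕ.^-identityʳ κ)))

      Small-trans : U ≼[ κ ^ℕ i ] V → Small j V → Small (i +ℕ j) U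
      Small-trans {i = i} {j = j} U≼V V≼H =
        AtMost-≤ (ℕ.≤-reflexive (≡.sym (ℕ.^-distribˡ-+-* κ i j))) (≼-trans U≼V V≼H)

      -- The additional 1 in the exponent pays for covering H + H by translates of H.
      Small-⊕ : Small i U → Small j V → Small (i +ℕ j +ℕ 1) (U ⊕ V)
      Small-⊕ {i = i} {j = j} U≼H V≼H =
        Small-trans {i = i +ℕ j}
          (AtMost-≤ (ℕ.≤-reflexive (≡.sym (ℕ.^-distribˡ-+-* κ i j))) (≼-⊕ U≼H V≼H)) (≼⇒Small H+H≼H)

      Small-⊖ : Small i U → Small j V → Small (i +ℕ j +ℕ 1) (U ⊖ V)
      Small-⊖ {i = i} {j = j} U≼H V≼H =
        Small-trans {i = i +ℕ j}
          (AtMost-≤ (ℕ.≤-reflexive (≡.sym (ℕ.^-distribˡ-+-* κ i j)))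
            (≼-⊆ʳ (λ (h , h′ , h∈H , h′∈H , x≈) → h , - h′ , h∈H , -‿closed h′∈H , x≈) (≼-⊖ U≼H V≼H)))
          (≼⇒Small H+H≼H)

      ◂-cong : x ≈ y → y ◂ U ⊆ x ◂ U
      ◂-cong x≈y (u , u∈U , w≈yu) = u , u∈U , ≈-trans w≈yu (*-congʳ (≈-sym x≈y))

      ◂-+ : (x + y) ◂ U ⊆ (x ◂ U) ⊕ (y ◂ U)
      ◂-+ {x} {y} (u , u∈U , w≈) =
        x * u , y * u , (u , u∈U , ≈-refl) , (u , u∈U , ≈-refl) , ≈-trans w≈ (distribʳ u x y)

      ◂-- : (x - y) ◂ U ⊆ (x ◂ U) ⊖ (y ◂ U)
      ◂-- {x} {y} (u , u∈U , w≈) =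
        x * u , y * u , (u , u∈U , ≈-refl) , (u , u∈U , ≈-refl) , ≈-trans w≈ ([y-z]x≈yx-zx u x y)

      ◂-⊕ : x ◂ (U ⊕ V) ⊆ (x ◂ U) ⊕ (x ◂ V)
      ◂-⊕ {x} (_ , (u , v , u∈U , v∈V , y≈u+v) , w≈) =
        x * u , x * v , (u , u∈U , ≈-refl) , (v , v∈V , ≈-refl) , ≈-trans w≈ (≈-trans (*-congˡ y≈u+v) (distribˡ x u v))

      ◂-⊖ : x ◂ (U ⊖ V) ⊆ (x ◂ U) ⊖ (x ◂ V)
      ◂-⊖ {x} (_ , (u , v , u∈U , v∈V , y≈u-v) , w≈) =
        x * u , x * v , (u , u∈U , ≈-refl) , (v , v∈V , ≈-refl) , ≈-trans w≈ (≈-trans (*-congˡ y≈u-v) (x[y-z]≈xy-xz x u v))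

      -- The exponents for A, A - A, H and H + H are 1, 3, 7 and 15: the first comes from `AA≼H`,
      -- and each sum or difference doubles the exponent and adds one.
      A◂ : x ∈ A → Small 1 (x ◂ A)
      A◂ {x} x∈A = AtMost-⊆ (λ (a , a∈A , w≈) → x , a , x∈A , a∈A , w≈) (≼⇒Small AA≼H)

      A-A◂ : x ∈ A ⊖ A → Small 3 (x ◂ A)
      A-A◂ (a , a′ , a∈A , a′∈A , x≈) =
        AtMost-⊆ (◂-- ∘ ◂-cong (≈-sym x≈)) (Small-⊖ {i = 1} {j = 1} (A◂ a∈A) (A◂ a′∈A))

      H◂ : x ∈ H → Small 7 (x ◂ A)
      H◂ x∈H = let d , d′ , d∈A-A , d′∈A-A , x≈ = H⊆4A x∈H in
        AtMost-⊆ (◂-+ ∘ ◂-cong (≈-sym x≈)) (Small-⊕ {i = 3} {j = 3} (A-A◂ d∈A-A) (A-A◂ d′∈A-A))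

      H+H◂ : x ∈ H ⊕ H → Small 15 (x ◂ A)
      H+H◂ (h , h′ , h∈H , h′∈H , x≈) =
        AtMost-⊆ (◂-+ ∘ ◂-cong (≈-sym x≈)) (Small-⊕ {i = 7} {j = 7} (H◂ h∈H) (H◂ h′∈H))

      -- The successor in the exponent accounts for the bound κ N on |H|.
      finite : Small i U → AtMost _≈_ U (κ ^ℕ suc i *ℕ N)
      finite {i} U≼H = AtMost-≤ (ℕ.≤-reflexive (regroup κ (κ ^ℕ i) N)) (≼-finite U≼H |H|≤κN)
        where
        regroup : ∀ κ κⁱ N → κⁱ *ℕ (κ *ℕ N) ≡ κ *ℕ κⁱ *ℕ N
        regroup = solve-∀

      -- A is covered by few translates of d A - d A, and x carries those to translates of e A - e A.
      quotient∈S : d ∈ A ⊖ A → R* d → e ∈ H ⊕ H → x * d ≈ e → x ∈ S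
      quotient∈S {d} {e} {x} d∈A-A d∈R* e∈H+H xd≈e = Small-trans {i = 6} {j = 31}
        -- As `d` is a non-zero-divisor, d A has `N` elements, while |A + d A| is at most κ⁶ N. The
        -- rest is the cost 31 = 15 + 15 + 1 of e A - e A.
        (≼-◂ x (Ruzsa-covering 0<N dA≥N (finite {5} (Small-⊕ {i = 1} {j = 3} (≼⇒Small A≼H) (A-A◂ d∈A-A)))))
        (AtMost-⊆ x◂[dA-dA]⊆eA-eA (Small-⊖ {i = 15} {j = 15} (H+H◂ e∈H+H) (H+H◂ e∈H+H)))
        where
        d*-injective : ∀ {a b} → d * a ≈ d * b → a ≈ b
        d*-injective {a} {b} da≈db = x∙y⁻¹≈ε⇒x≈y a b (decidable-stable em λ a-b≉0 →
          proj₁ (d∈R* (a - b) a-b≉0) (≈-trans (x[y-z]≈xy-xz d a b) (x≈y⇒x∙y⁻¹≈ε da≈db)))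

        dA≥N : AtLeast _≈_ (d ◂ A) N
        dA≥N = AtLeast-map (d *_) (λ {a} a∈A → a , a∈A , ≈-refl) d*-injective A≥N

        x◂dA : ∀ {w} → w ∈ d ◂ A → x * w ∈ e ◂ A
        x◂dA {w} (a , a∈A , w≈da) = a , a∈A , (begin
          x * w       ≈⟨ *-congˡ w≈da ⟩
          x * (d * a) ≈⟨ *-assoc x d a ⟨
          x * d * a   ≈⟨ *-congʳ xd≈e ⟩
          e * a       ∎)

        x◂[dA-dA]⊆eA-eA : x ◂ ((d ◂ A) ⊖ (d ◂ A)) ⊆ (e ◂ A) ⊖ (e ◂ A)
        x◂[dA-dA]⊆eA-eA (_ , (w , w′ , w∈dA , w′∈dA , v≈) , y≈) =
          x * w , x * w′ , x◂dA w∈dA , x◂dA w′∈dA , ≈-trans y≈ (≈-trans (*-congˡ v≈) (x[y-z]≈xy-xz x w w′))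

      -- Each such `d` exhibits `x` as a fraction with denominator `d` and numerator `x * d` in H +
      -- H.
      Denominator : Carrier → Subset
      Denominator x d = d ∈ A ⊖ A × R* d × x * d ∈ H ⊕ H

      -- If x a and x a₀ lie in the same translate of H, then a - a₀ is a denominator or a zero divisor.
      denominators-many : ∀ {x M g} → x ◂ A ≼[ M ] H → AtMost _≈_ (Denominator x) g → N ≤ M *ℕ (z +ℕ g)
      denominators-many {x} {M} {g} xA≼H denominators≤g = pigeonhole A≥N
        (AtMost-refine {R = λ ξ a → Translate H ξ (x * a)}
          (AtMost-map id (λ {a} a∈A → x * a , (a , a∈A , ≈-refl) , id) xA≼H) fibre)
        same
        where
        fibre : ∀ ξ → AtMost _≈_ (λ a → a ∈ A × Translate H ξ (x * a)) (z +ℕ g)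
        fibre ξ with em {P = ∃ λ a → a ∈ A × Translate H ξ (x * a)}
        ... | no  empty = [] , z≤n , λ a∈ → ⊥-elim (empty (_ , a∈))
        ... | yes (a₀ , a₀∈A , h₀ , h₀∈H , xa₀≈ξ+h₀) =
          AtMost-map (_+ a₀)
            (λ {a} (a∈A , h , h∈H , xa≈ξ+h) → a - a₀ ,
              split (a , a₀ , a∈A , a₀∈A , ≈-refl)
                    (h , - h₀ , h∈H , -‿closed h₀∈H , (begin
                      x * (a - a₀)           ≈⟨ x[y-z]≈xy-xz x a a₀ ⟩
                      x * a - x * a₀         ≈⟨ +-cong xa≈ξ+h (-‿cong xa₀≈ξ+h₀) ⟩
                      (ξ + h) - (ξ + h₀)     ≈⟨ -‿interchange ξ h ξ h₀ ⟩
                      (ξ - ξ) + (h - h₀)     ≈⟨ +-congʳ (-‿inverseʳ ξ) ⟩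
                      0# + (h - h₀)          ≈⟨ +-identityˡ (h - h₀) ⟩
                      h - h₀                 ∎)) ,
              λ y≈a-a₀ → ≈-trans (+-congʳ y≈a-a₀) ([x-y]+y≈x a a₀))
            (AtMost-∪ zeroDivisors≤z denominators≤g)
          where
          split : d ∈ A ⊖ A → x * d ∈ H ⊕ H → d ∈ (λ d → d ∈ A ⊖ A × ¬ R* d) ∪ Denominator x
          split {d} d∈A-A xd∈H+H with em {P = R* d}
          ... | yes d∈R* = inj₂ (d∈A-A , d∈R* , xd∈H+H)
          ... | no  d∉R* = inj₁ (d∈A-A , d∉R*)

      -- The self-improvement: a single denominator brings the exponent 188 down to 37, and having
      -- none would force N ≤ κ¹⁸⁸ z.
      improve : Small 188 (x ◂ A) → x ∈ S
      improve {x} xA≼H with dichotomy em _≈_ (Denominator x) 0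
      ... | inj₁ none = contradiction (denominators-many xA≼H none) (ℕ.<⇒≱ M[z+0]<N)
        where
        M[z+0]<N : κ ^ℕ 188 *ℕ (z +ℕ 0) < N
        M[z+0]<N = ℕ.≤-<-trans
          (ℕ.≤-trans (ℕ.≤-reflexive (≡.cong (κ ^ℕ 188 *ℕ_) (ℕ.+-identityʳ z))) (ℕ.m≤m+n _ _)) 2κ¹⁸⁸z<N
      ... | inj₂ some = let d , d∈A-A , d∈R* , xd∈H+H = AtLeast-inhabited (s≤s z≤n) some in
                        quotient∈S d∈A-A d∈R* xd∈H+H ≈-refl

      A⊆S : A ⊆ S
      A⊆S a∈A = AtMost-≤ (κ^-mono 1 37) (A◂ a∈A)

      S-resp : S Respects _≈_
      S-resp x≈y = AtMost-⊆ (◂-cong x≈y)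

      S-- : x ∈ S → y ∈ S → x - y ∈ S
      S-- x∈S y∈S = improve (AtMost-≤ (κ^-mono 75 188) (AtMost-⊆ ◂-- (Small-⊖ {i = 37} {j = 37} x∈S y∈S)))

      S-+ : x ∈ S → y ∈ S → x + y ∈ S
      S-+ x∈S y∈S = improve (AtMost-≤ (κ^-mono 75 188) (AtMost-⊆ ◂-+ (Small-⊕ {i = 37} {j = 37} x∈S y∈S)))

      S-0 : 0# ∈ S
      S-0 = let a , a∈A = AtLeast-inhabited 0<N A≥N in S-resp (-‿inverseʳ a) (S-- (A⊆S a∈A) (A⊆S a∈A))

      -- x y A lies in κ³⁷ translates of x H. Since H lies in (A - A) + (A - A), x H has exponent
      -- 151 = 75 + 75 + 1, where 75 = 37 + 37 + 1 is that of x (A - A). The total is 188 = 37 +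
      -- 151.
      S-* : x ∈ S → y ∈ S → x * y ∈ S
      S-* {x} {y} x∈S y∈S = improve (AtMost-⊆
        (λ (a , a∈A , w≈) → y * a , (a , a∈A , ≈-refl) , ≈-trans w≈ (*-assoc x y a))
        (Small-trans {i = 37} {j = 151} (≼-◂ x y∈S) xH-small))
        where
        xH-small : Small 151 (x ◂ H)
        xH-small = AtMost-⊆
          (λ (h , h∈H , w≈) → ◂-⊕ {x} {A ⊖ A} {A ⊖ A} (h , H⊆4A h∈H , w≈))
          (Small-⊕ {i = 75} {j = 75} xA-xA-small xA-xA-small)
          where
          xA-xA-small : Small 75 (x ◂ (A ⊖ A))
          xA-xA-small = AtMost-⊆ ◂-⊖ (Small-⊖ {i = 37} {j = 37} x∈S x∈S)

      S-isSubring : IsSubring S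
      S-isSubring = record
        { resp     = S-resp
        ; 0∈       = S-0
        ; +-closed = S-+
        ; -‿closed = λ {x} x∈S → S-resp (+-identityˡ (- x)) (S-- S-0 x∈S)
        ; *-closed = S-*
        }

      -- Each `x` in S has at least N / 2κ³⁷ denominators `d`. The pairs (d, x d) determine `x` and
      -- lie in the product of A - A and H + H, of sizes at most κ⁴ N and κ² N; hence 43 = 37 + 4 +
      -- 2.
      S-size : AtMost _≈_ S (2 *ℕ κ ^ℕ 43 *ℕ N)
      S-size with quotient {2 *ℕ κ ^ℕ 37} {N} (*-positive {2} (s≤s z≤n) (ℕ.m^n>0 κ {{>-nonZero 0<κ}} 37)) 0<N
      ... | g , 2κ³⁷g<N , N≤2κ³⁷[1+g] = atMost em _≈_ S λ m m≤S →
        ℕ.≤-trans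
          (cancel-average {c = 2 *ℕ κ ^ℕ 37} {m = m} 0<N N≤2κ³⁷[1+g]
            (ℕ.≤-trans (count m m≤S) (ℕ.≤-reflexive (regroup (κ ^ℕ 4) (κ ^ℕ 2) N))))
          (ℕ.≤-reflexive (≡.trans (regroup′ (κ ^ℕ 37) (κ ^ℕ 4) (κ ^ℕ 2) N)
            (≡.cong (λ κ⁴³ → 2 *ℕ κ⁴³ *ℕ N) κ³⁷κ⁴κ²≡κ⁴³)))
        where
        regroup : ∀ κ⁴ κ² N → κ⁴ *ℕ N *ℕ (κ² *ℕ N) ≡ κ⁴ *ℕ κ² *ℕ N *ℕ N
        regroup = solve-∀

        regroup′ : ∀ κ³⁷ κ⁴ κ² N → 2 *ℕ κ³⁷ *ℕ (κ⁴ *ℕ κ² *ℕ N) ≡ 2 *ℕ (κ³⁷ *ℕ (κ⁴ *ℕ κ²)) *ℕ N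
        regroup′ = solve-∀

        κ³⁷κ⁴κ²≡κ⁴³ : κ ^ℕ 37 *ℕ (κ ^ℕ 4 *ℕ κ ^ℕ 2) ≡ κ ^ℕ 43
        κ³⁷κ⁴κ²≡κ⁴³ = ≡.sym (≡.trans (ℕ.^-distribˡ-+-* κ 37 6) (≡.cong (κ ^ℕ 37 *ℕ_) (ℕ.^-distribˡ-+-* κ 4 2)))

        -- At most `g` denominators would give N < 2κ³⁷ g, against the choice of `g`.
        denominators : ∀ {x} → x ∈ S → AtLeast _≈_ (Denominator x) (suc g)
        denominators {x} x∈S with dichotomy em _≈_ (Denominator x) g
        ... | inj₂ many = many
        ... | inj₁ few  = contradiction
          (multiplier-count {N} {z} {κ ^ℕ 37} {g}
            (ℕ.≤-<-trans (ℕ.*-monoʳ-≤ 2 (ℕ.*-monoˡ-≤ z (κ^-mono 37 188))) 2κ¹⁸⁸z<N)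
            (denominators-many x∈S few))
          (ℕ.<-asym 2κ³⁷g<N)

        *d-injective : ∀ {x y d} → R* d → x * d ≈ y * d → x ≈ y
        *d-injective {x} {y} {d} d∈R* xd≈yd = x∙y⁻¹≈ε⇒x≈y x y (decidable-stable em λ x-y≉0 →
          proj₂ (d∈R* (x - y) x-y≉0) (≈-trans ([y-z]x≈yx-zx d x y) (x≈y⇒x∙y⁻¹≈ε xd≈yd)))

        count : ∀ m → AtLeast _≈_ S m → m *ℕ suc g ≤ κ ^ℕ 4 *ℕ N *ℕ (κ ^ℕ 2 *ℕ N)
        count m m≤S = double-counting {_≈_ = Pointwise _≈_ _≈_}
          {V = λ (d , e) → d ∈ A ⊖ A × e ∈ H ⊕ H} {R = λ x (d , e) → R* d × x * d ≈ e} m≤S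
          (λ {x} x∈S → AtLeast-map (λ d → d , x * d)
            (λ (d∈A-A , d∈R* , xd∈H+H) → (d∈A-A , xd∈H+H) , (d∈R* , ≈-refl)) proj₁ (denominators x∈S))
          (λ (d∈R* , xd≈e) (_ , x′d′≈e′) (d′≈d , e′≈e) → *d-injective d∈R*
            (≈-trans (*-congˡ (≈-sym d′≈d)) (≈-trans x′d′≈e′ (≈-trans e′≈e (≈-sym xd≈e)))))
          (AtMost-× (finite {3} (Small-⊖ {i = 1} {j = 1} (≼⇒Small A≼H) (≼⇒Small A≼H)))
                    (finite {1} (≼⇒Small H+H≼H)))
          same₂

  -- Opaque, because fromℕ and _^_ would otherwise unfold the constant in unary.
  opaque
    degree : ℕ
    degree = 53 *ℕ 188

    [x⁵³]¹⁸⁸≡x^degree : ∀ x → (x ^ℕ 53) ^ℕ 188 ≡ x ^ℕ degree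
    [x⁵³]¹⁸⁸≡x^degree x = ℕ.^-*-assoc x 53 188

  -- One number bounds both factor and exponent: if K ≤ 2κ for the given parameter κ, then 2
  -- (2K)^degree is at most 2 4^degree κ^degree.
  absoluteConstant : ℕ
  absoluteConstant = 2 *ℕ 4 ^ℕ degree +ℕ degree

  0<absoluteConstant : 0 < absoluteConstant
  0<absoluteConstant = ℕ.≤-trans (*-positive {2} (s≤s z≤n) (ℕ.m^n>0 4 degree)) (ℕ.m≤m+n _ degree)

  -- Exact cardinalities, and the theorem for a natural number K.

  module Cardinality (em : ∀ {e : Level} → ExcludedMiddle e) {c ℓ : Level} (R : RingWithoutOne c ℓ) where
    open RingWithoutOne R renaming (refl to ≈-refl; sym to ≈-sym; trans to ≈-trans; reflexive to ≈-reflexive)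
    open RingWithoutOneProperties R
    open SubsetsOf R
    open Sumsets em R
    open Multipliers em R
    open SetoidMembership setoid using () renaming (_∈_ to _∈ₗ_)

    private variable
      u : Level
      U : Pred Carrier u
      m n : ℕ

    ∣∣≡⇒AtMost : ∣ U ∣≡ n → AtMost _≈_ U n
    ∣∣≡⇒AtMost (xs , _ , U⇔xs , |xs|≡n) =
      xs , ℕ.≤-reflexive |xs|≡n , λ x∈U → Any.map ≈-sym (Equivalence.to (U⇔xs _) x∈U)

    ∣∣≡⇒AtLeast : ∣ U ∣≡ n → AtLeast _≈_ U n
    ∣∣≡⇒AtLeast (xs , xs-unique , U⇔xs , |xs|≡n) =
      xs , AllPairs.map (λ x≉y y≈x → x≉y (≈-sym y≈x)) xs-unique ,
      All.tabulateₛ setoid (λ {x} x∈xs → Equivalence.from (U⇔xs x) x∈xs) , |xs|≡n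

    ∣∣≡-positive : ∀ {x} → U x → ∣ U ∣≡ n → 0 < n
    ∣∣≡-positive {x = x} x∈U |U| = pigeonhole (x ∷ [] , [] ∷ [] , x∈U ∷ [] , ≡.refl) (∣∣≡⇒AtMost |U|) same

    -- Descent on the bound: `n` distinct elements of `U` are all of `U`, as one more would exceed
    -- the bound; without them the bound drops by one.
    ∃∣∣≡ : ∀ {n} → U Respects _≈_ → AtMost _≈_ U n → ∃ λ m → ∣ U ∣≡ m × m ≤ n
    ∃∣∣≡ {U = U} {n} U-resp U≤n with em {P = AtLeast _≈_ U n}
    ... | yes (xs , xs-distinct , xs∈U , ≡.refl) = n ,
      (xs , AllPairs.map (λ y≉x x≈y → y≉x (≈-sym x≈y)) xs-distinct , (λ x → mk⇔ (complete x) (sound x)) , ≡.refl) ,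
      ℕ.≤-refl
      where
      complete : ∀ x → U x → x ∈ₗ xs
      complete x x∈U = decidable-stable em λ x∉xs →
        ℕ.<⇒≱ (ℕ.n<1+n _) (pigeonhole
          (x ∷ xs , All.map (λ x≉y y≈x → x≉y (≈-sym y≈x)) (All.¬Any⇒All¬ xs x∉xs) ∷ xs-distinct , x∈U ∷ xs∈U , ≡.refl)
          U≤n same)
      sound : ∀ x → x ∈ₗ xs → U x
      sound x = All.lookupₛ setoid U-resp xs∈U
    ∃∣∣≡ {U = U} {zero} U-resp U≤0 | no ¬U≥0 = contradiction ([] , [] , [] , ≡.refl) ¬U≥0
    ∃∣∣≡ {U = U} {suc n} U-resp U≤n | no ¬U≥n with dichotomy em _≈_ U n
    ... | inj₂ U>n  = contradiction U>n ¬U≥n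
    ... | inj₁ U≤n′ = let m , |U|≡m , m≤n = ∃∣∣≡ U-resp U≤n′ in m , |U|≡m , ℕ.m≤n⇒m≤1+n m≤n

    R*-resp : R* Respects _≈_
    R*-resp x≈y x∈R* a a≉0 = let l , r = x∈R* a a≉0 in
      (λ ya≈0 → l (≈-trans (*-congʳ x≈y) ya≈0)) , (λ ay≈0 → r (≈-trans (*-congˡ x≈y) ay≈0))

    -- Either the differences outside `R*` are many, or the negated inequality is the hypothesis
    -- 2κ¹⁸⁸ z < N under which S is a ring, with κ = (2K)⁵³.
    sum-product : ∀ {p} {A : Pred Carrier p} {N a b K} → ∣ A ∣≡ N → ∣ A ⊕ A ⊙ A ∣≡ a → ∣ A ⊙ A ∣≡ b →
      0 < N → 0 < K → a ≤ K *ℕ N → N ≤ K *ℕ b →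
      (∃ λ z → ∣ (A ⊖ A) ∖ R* ∣≡ z × N ≤ 2 *ℕ (2 *ℕ K) ^ℕ degree *ℕ z) ⊎
      (∃ λ (S : Subset) → IsSubring S × A ⊆ S × ∃ λ s → ∣ S ∣≡ s × s ≤ 2 *ℕ (2 *ℕ K) ^ℕ degree *ℕ N)
    sum-product {A = A} {N} {a} {b} {K} |A| |A+AA| |AA| 0<N 0<K a≤KN N≤Kb
      -- Any finite bound yields an exact cardinality `z`; pairs from A give N².
      with ∃∣∣≡ {U = (A ⊖ A) ∖ R*} {N *ℕ N}
             (λ x≈y ((a , a′ , a∈A , a′∈A , x≈) , x∉R*) →
               (a , a′ , a∈A , a′∈A , ≈-trans (≈-sym x≈y) x≈) , λ y∈R* → x∉R* (R*-resp (≈-sym x≈y) y∈R*))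
             (AtMost-map (uncurry _-_)
               (λ ((a , a′ , a∈A , a′∈A , x≈) , _) → (a , a′) , (a∈A , a′∈A) ,
                 λ (y≈a , y′≈a′) → ≈-trans (+-cong y≈a (-‿cong y′≈a′)) (≈-sym x≈))
               (AtMost-× (∣∣≡⇒AtMost |A|) (∣∣≡⇒AtMost |A|)))
    ... | z , |Z| , _ with N ℕ.≤? 2 *ℕ (2 *ℕ K) ^ℕ degree *ℕ z
    ...   | yes N≤ = inj₁ (z , |Z| , N≤)
    ...   | no  N≰ =
      let s , |S| , s≤ = ∃∣∣≡ S-resp S-size in
      inj₂ (S , S-isSubring , (λ x∈A → A⊆S (to x∈A)) , s , |S| , ℕ.≤-trans s≤ (ℕ.*-monoˡ-≤ N (ℕ.*-monoʳ-≤ 2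
        (ℕ.≤-trans (κ^-mono 43 188) (ℕ.≤-reflexive ([x⁵³]¹⁸⁸≡x^degree (2 *ℕ K)))))))
      where
      xs = proj₁ |A|
      -- A may live at any level; membership in its list is the same set at the level of `Subset`.
      A′ : Subset
      A′ x = x ∈ₗ xs
      to : A ⊆ A′
      to {x} = Equivalence.to (proj₁ (proj₂ (proj₂ |A|)) x)
      from : A′ ⊆ A
      from {x} = Equivalence.from (proj₁ (proj₂ (proj₂ |A|)) x)
      κ = (2 *ℕ K) ^ℕ 53
      A′-resp : A′ Respects _≈_
      A′-resp x≈y = Any.map (≈-trans (≈-sym x≈y))
      A′≥N : AtLeast _≈_ A′ N
      A′≥N = AtLeast-map id to id (∣∣≡⇒AtLeast |A|)
      A′≤N : AtMost _≈_ A′ N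
      A′≤N = AtMost-⊆ from (∣∣≡⇒AtMost |A|)
      control : ∃ λ H → Controls H A′ N κ
      control = controlled A′-resp 0<N A′≥N A′≤N 0<K
        (AtLeast-map id (λ (a , b , a∈A , b∈A , eq) → a , b , to a∈A , to b∈A , eq) id (∣∣≡⇒AtLeast |AA|))
        N≤Kb
        (AtMost-≤ a≤KN (AtMost-⊆
          (λ (a , b , a∈A , (b₁ , b₂ , b₁∈ , b₂∈ , eq′) , eq) → a , b , from a∈A , (b₁ , b₂ , from b₁∈ , from b₂∈ , eq′) , eq)
          (∣∣≡⇒AtMost |A+AA|)))
      0<κ : 0 < κ
      0<κ = ℕ.m^n>0 (2 *ℕ K) {{>-nonZero (*-positive {2} (s≤s z≤n) 0<K)}} 53
      2κ¹⁸⁸z<N : 2 *ℕ (κ ^ℕ 188 *ℕ z) < N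
      2κ¹⁸⁸z<N = ℕ.≤-<-trans (ℕ.≤-reflexive
        (≡.trans (≡.sym (ℕ.*-assoc 2 (κ ^ℕ 188) z)) (≡.cong (λ x → 2 *ℕ x *ℕ z) ([x⁵³]¹⁸⁸≡x^degree (2 *ℕ K))))) (ℕ.≰⇒> N≰)

      zeroDivisors≤z : AtMost _≈_ (λ d → d ∈ A′ ⊖ A′ × ¬ R* d) z
      zeroDivisors≤z = AtMost-⊆
        (λ ((a , a′ , a∈A , a′∈A , x≈) , x∉R*) → (a , a′ , from a∈A , from a′∈A , x≈) , x∉R*) (∣∣≡⇒AtMost |Z|)

      open Construction A′-resp 0<N 0<κ A′≥N A′≤N (proj₂ control) zeroDivisors≤z 2κ¹⁸⁸z<N

  -- Ordered field arithmetic, and the passage to a natural number K.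

  module OrderedFieldProperties {f ℓ₁ ℓ₂ : Level} (F : OrderedField f ℓ₁ ℓ₂) where
    open OrderedField F public renaming (_≤_ to infix 4 _≤ᶠ_; refl to ≈-refl; sym to ≈-sym; trans to ≈-trans)
    open RingProperties ring
    open CommutativeSemigroupProperties *-commutativeSemigroup using () renaming (interchange to *-interchange)
    open IsTotalOrder isTotalOrder public
      using (total; antisym)
      renaming (refl to ≤ᶠ-refl; trans to ≤ᶠ-trans; reflexive to ≤ᶠ-reflexive; isPartialOrder to ≤ᶠ-isPartialOrder)

    ≤ᶠ-poset : Poset f ℓ₁ ℓ₂
    ≤ᶠ-poset = record { isPartialOrder = ≤ᶠ-isPartialOrder }

    open PartialOrderReasoning ≤ᶠ-poset public

    private variable
      w x y z : Carrier
      m n : ℕ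

    +-mono-≤ᶠ : w ≤ᶠ x → y ≤ᶠ z → w + y ≤ᶠ x + z
    +-mono-≤ᶠ {w} {x} {y} {z} w≤x y≤z = begin
      w + y ≤⟨ +-monoʳ-≤ w y≤z ⟩
      w + z ≈⟨ +-comm w z ⟩
      z + w ≤⟨ +-monoʳ-≤ z w≤x ⟩
      z + x ≈⟨ +-comm z x ⟩
      x + z ∎

    *-monoʳ-≤ᶠ : 0# ≤ᶠ x → y ≤ᶠ z → x * y ≤ᶠ x * z
    *-monoʳ-≤ᶠ {x} {y} {z} 0≤x y≤z = begin
      x * y                     ≈⟨ +-identityʳ (x * y) ⟨
      x * y + 0#                ≤⟨ +-monoʳ-≤ (x * y) (*-nonNeg 0≤x 0≤z-y) ⟩
      x * y + x * (z - y)       ≈⟨ distribˡ x y (z - y) ⟨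
      x * (y + (z - y))         ≈⟨ *-congˡ (≈-trans (+-comm y (z - y)) (//-rightDividesˡ y z)) ⟩
      x * z                     ∎
      where
      0≤z-y : 0# ≤ᶠ z - y
      0≤z-y = begin
        0#      ≈⟨ -‿inverseˡ y ⟨
        - y + y ≤⟨ +-monoʳ-≤ (- y) y≤z ⟩
        - y + z ≈⟨ +-comm (- y) z ⟩
        z - y   ∎

    *-monoˡ-≤ᶠ : 0# ≤ᶠ x → y ≤ᶠ z → y * x ≤ᶠ z * x
    *-monoˡ-≤ᶠ {x} {y} {z} 0≤x y≤z = begin
      y * x ≈⟨ *-comm y x ⟩
      x * y ≤⟨ *-monoʳ-≤ᶠ 0≤x y≤z ⟩
      x * z ≈⟨ *-comm x z ⟩
      z * x ∎

    0≤x² : ∀ x → 0# ≤ᶠ x * x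
    0≤x² x with total 0# x
    ... | inj₁ 0≤x = *-nonNeg 0≤x 0≤x
    ... | inj₂ x≤0 = begin
      0#        ≤⟨ *-nonNeg 0≤-x 0≤-x ⟩
      - x * - x ≈⟨ -‿distribˡ-* x (- x) ⟨
      - (x * - x) ≈⟨ -‿cong (-‿distribʳ-* x x) ⟨
      - - (x * x) ≈⟨ -‿involutive (x * x) ⟩
      x * x     ∎
      where
      0≤-x : 0# ≤ᶠ - x
      0≤-x = begin
        0#       ≈⟨ -‿inverseˡ x ⟨
        - x + x  ≤⟨ +-monoʳ-≤ (- x) x≤0 ⟩
        - x + 0# ≈⟨ +-identityʳ (- x) ⟩
        - x      ∎

    0≤1 : 0# ≤ᶠ 1#
    0≤1 = ≤ᶠ-trans (0≤x² 1#) (≤ᶠ-reflexive (*-identityʳ 1#))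

    1≤⇒≉0 : 1# ≤ᶠ x → ¬ x ≈ 0#
    1≤⇒≉0 1≤x x≈0 = 0≉1 (antisym 0≤1 (≤ᶠ-trans 1≤x (≤ᶠ-reflexive x≈0)))

    -- `x ⁻¹` is `x` times the square of `x ⁻¹`.
    ⁻¹-nonNeg : 1# ≤ᶠ x → 0# ≤ᶠ x ⁻¹
    ⁻¹-nonNeg {x} 1≤x = begin
      0#               ≤⟨ *-nonNeg (≤ᶠ-trans 0≤1 1≤x) (0≤x² (x ⁻¹)) ⟩
      x * (x ⁻¹ * x ⁻¹) ≈⟨ *-assoc x (x ⁻¹) (x ⁻¹) ⟨
      x * x ⁻¹ * x ⁻¹   ≈⟨ *-congʳ (⁻¹-inverseʳ x (1≤⇒≉0 1≤x)) ⟩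
      1# * x ⁻¹         ≈⟨ *-identityˡ (x ⁻¹) ⟩
      x ⁻¹              ∎

    *-cancelʳ-≤ᶠ : 1# ≤ᶠ x → y * x ≤ᶠ z * x → y ≤ᶠ z
    *-cancelʳ-≤ᶠ {x} {y} {z} 1≤x yx≤zx = begin
      y               ≈⟨ undo y ⟨
      y * x * x ⁻¹    ≤⟨ *-monoˡ-≤ᶠ (⁻¹-nonNeg 1≤x) yx≤zx ⟩
      z * x * x ⁻¹    ≈⟨ undo z ⟩
      z               ∎
      where
      undo : ∀ y → y * x * x ⁻¹ ≈ y
      undo y = ≈-trans (*-assoc y x (x ⁻¹)) (≈-trans (*-congˡ (⁻¹-inverseʳ x (1≤⇒≉0 1≤x))) (*-identityʳ y))

    1≤* : 1# ≤ᶠ x → 1# ≤ᶠ y → 1# ≤ᶠ x * y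
    1≤* {x} {y} 1≤x 1≤y = begin
      1#     ≤⟨ 1≤x ⟩
      x      ≈⟨ *-identityʳ x ⟨
      x * 1# ≤⟨ *-monoʳ-≤ᶠ (≤ᶠ-trans 0≤1 1≤x) 1≤y ⟩
      x * y  ∎

    1≤^ : 1# ≤ᶠ x → ∀ n → 1# ≤ᶠ x ^ n
    1≤^ 1≤x zero    = ≤ᶠ-refl
    1≤^ 1≤x (suc n) = 1≤* 1≤x (1≤^ 1≤x n)

    ^-monoʳ-≤ᶠ : 1# ≤ᶠ x → m ≤ n → x ^ m ≤ᶠ x ^ n
    ^-monoʳ-≤ᶠ {n = n} 1≤x z≤n       = 1≤^ 1≤x n
    ^-monoʳ-≤ᶠ         1≤x (s≤s m≤n) = *-monoʳ-≤ᶠ (≤ᶠ-trans 0≤1 1≤x) (^-monoʳ-≤ᶠ 1≤x m≤n)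

    ^-nonNeg : 0# ≤ᶠ x → ∀ n → 0# ≤ᶠ x ^ n
    ^-nonNeg 0≤x zero    = 0≤1
    ^-nonNeg 0≤x (suc n) = *-nonNeg 0≤x (^-nonNeg 0≤x n)

    ^-monoˡ-≤ᶠ : 0# ≤ᶠ x → x ≤ᶠ y → ∀ n → x ^ n ≤ᶠ y ^ n
    ^-monoˡ-≤ᶠ 0≤x x≤y zero    = ≤ᶠ-refl
    ^-monoˡ-≤ᶠ 0≤x x≤y (suc n) =
      ≤ᶠ-trans (*-monoʳ-≤ᶠ 0≤x (^-monoˡ-≤ᶠ 0≤x x≤y n)) (*-monoˡ-≤ᶠ (^-nonNeg (≤ᶠ-trans 0≤x x≤y) n) x≤y)

    fromℕ-mono : m ≤ n → fromℕ m ≤ᶠ fromℕ n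
    fromℕ-mono {n = zero}  z≤n       = ≤ᶠ-refl
    fromℕ-mono {n = suc n} z≤n       = begin
      0#              ≈⟨ +-identityʳ 0# ⟨
      0# + 0#         ≤⟨ +-mono-≤ᶠ 0≤1 (fromℕ-mono (z≤n {n})) ⟩
      1# + fromℕ n    ∎
    fromℕ-mono             (s≤s m≤n) = +-monoʳ-≤ 1# (fromℕ-mono m≤n)

    fromℕ-nonNeg : ∀ n → 0# ≤ᶠ fromℕ n
    fromℕ-nonNeg n = fromℕ-mono (z≤n {n})

    1≤fromℕ : 0 < n → 1# ≤ᶠ fromℕ n
    1≤fromℕ 0<n = ≤ᶠ-trans (≤ᶠ-reflexive (≈-sym (+-identityʳ 1#))) (fromℕ-mono 0<n)

    fromℕ-* : ∀ m n → fromℕ (m *ℕ n) ≈ fromℕ m * fromℕ n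
    fromℕ-* = Mult.×1-homo-* semiring

    fromℕ-^ : ∀ m n → fromℕ (m ^ℕ n) ≈ fromℕ m ^ n
    fromℕ-^ m zero    = +-identityʳ 1#
    fromℕ-^ m (suc n) = ≈-trans (fromℕ-* m (m ^ℕ n)) (*-congˡ (fromℕ-^ m n))

    *-≤⇒fromℕ≤ : ∀ {q d n} → 0 < d → d *ℕ q ≤ n → fromℕ n ≤ᶠ x * fromℕ d → fromℕ q ≤ᶠ x
    *-≤⇒fromℕ≤ {x} {q} {d} {n} 0<d dq≤n n≤xd = *-cancelʳ-≤ᶠ (1≤fromℕ 0<d) (begin
      fromℕ q * fromℕ d  ≈⟨ *-comm (fromℕ q) (fromℕ d) ⟩
      fromℕ d * fromℕ q  ≈⟨ fromℕ-* d q ⟨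
      fromℕ (d *ℕ q)     ≤⟨ fromℕ-mono dq≤n ⟩
      fromℕ n            ≤⟨ n≤xd ⟩
      x * fromℕ d        ∎)

    polynomial-bound : ∀ e K {κ} → 1# ≤ᶠ κ → fromℕ K ≤ᶠ fromℕ 2 * κ →
      let C = 2 *ℕ 4 ^ℕ e +ℕ e in fromℕ (2 *ℕ (2 *ℕ K) ^ℕ e) ≤ᶠ fromℕ C * κ ^ C
    polynomial-bound e K {κ} 1≤κ K≤2κ = begin
      fromℕ (2 *ℕ (2 *ℕ K) ^ℕ e)              ≈⟨ fromℕ-* 2 ((2 *ℕ K) ^ℕ e) ⟩
      fromℕ 2 * fromℕ ((2 *ℕ K) ^ℕ e)         ≈⟨ *-congˡ (fromℕ-^ (2 *ℕ K) e) ⟩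
      fromℕ 2 * fromℕ (2 *ℕ K) ^ e            ≤⟨ *-monoʳ-≤ᶠ (fromℕ-nonNeg 2) (^-monoˡ-≤ᶠ (fromℕ-nonNeg (2 *ℕ K)) 2K≤4κ e) ⟩
      fromℕ 2 * (fromℕ 4 * κ) ^ e             ≈⟨ *-congˡ (Exp.^-distrib-* commutativeSemiring (fromℕ 4) κ e) ⟩
      fromℕ 2 * (fromℕ 4 ^ e * κ ^ e)         ≈⟨ *-assoc (fromℕ 2) _ _ ⟨
      fromℕ 2 * fromℕ 4 ^ e * κ ^ e           ≈⟨ *-congʳ (*-congˡ (fromℕ-^ 4 e)) ⟨
      fromℕ 2 * fromℕ (4 ^ℕ e) * κ ^ e        ≈⟨ *-congʳ (fromℕ-* 2 (4 ^ℕ e)) ⟨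
      fromℕ (2 *ℕ 4 ^ℕ e) * κ ^ e             ≤⟨ *-monoˡ-≤ᶠ (≤ᶠ-trans 0≤1 (1≤^ 1≤κ e)) (fromℕ-mono (ℕ.m≤m+n (2 *ℕ 4 ^ℕ e) e)) ⟩
      fromℕ C * κ ^ e                         ≤⟨ *-monoʳ-≤ᶠ (fromℕ-nonNeg C) (^-monoʳ-≤ᶠ 1≤κ (ℕ.m≤n+m e (2 *ℕ 4 ^ℕ e))) ⟩
      fromℕ C * κ ^ C                         ∎
      where
      C = 2 *ℕ 4 ^ℕ e +ℕ e
      2K≤4κ : fromℕ (2 *ℕ K) ≤ᶠ fromℕ 4 * κ
      2K≤4κ = begin
        fromℕ (2 *ℕ K)           ≈⟨ fromℕ-* 2 K ⟩
        fromℕ 2 * fromℕ K        ≤⟨ *-monoʳ-≤ᶠ (fromℕ-nonNeg 2) K≤2κ ⟩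
        fromℕ 2 * (fromℕ 2 * κ)  ≈⟨ *-assoc (fromℕ 2) (fromℕ 2) κ ⟨
        fromℕ 2 * fromℕ 2 * κ    ≈⟨ *-congʳ (fromℕ-* 2 2) ⟨
        fromℕ 4 * κ              ∎

    -- Rounding up costs at most a factor 2, because 1 ≤ κ.
    suc≤2* : ∀ q {κ} → 1# ≤ᶠ κ → fromℕ q ≤ᶠ κ → fromℕ (suc q) ≤ᶠ fromℕ 2 * κ
    suc≤2* q {κ} 1≤κ q≤κ = begin
      1# + fromℕ q            ≤⟨ +-mono-≤ᶠ 1≤κ q≤κ ⟩
      κ + κ                   ≈⟨ +-cong (*-identityˡ κ) (*-identityˡ κ) ⟨
      1# * κ + 1# * κ         ≈⟨ distribʳ κ 1# 1# ⟨
      (1# + 1#) * κ           ≈⟨ *-congʳ (+-congˡ (+-identityʳ 1#)) ⟨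
      fromℕ 2 * κ             ∎

    divide : ∀ {w x y z} → 1# ≤ᶠ x → 1# ≤ᶠ y → w ≤ᶠ x * y * z → x ⁻¹ * y ⁻¹ * w ≤ᶠ z
    divide {w} {x} {y} {z} 1≤x 1≤y w≤xyz = begin
      x ⁻¹ * y ⁻¹ * w                ≤⟨ *-monoʳ-≤ᶠ (*-nonNeg (⁻¹-nonNeg 1≤x) (⁻¹-nonNeg 1≤y)) w≤xyz ⟩
      x ⁻¹ * y ⁻¹ * (x * y * z)      ≈⟨ *-assoc (x ⁻¹ * y ⁻¹) (x * y) z ⟨
      x ⁻¹ * y ⁻¹ * (x * y) * z      ≈⟨ *-congʳ (*-interchange (x ⁻¹) (y ⁻¹) x y) ⟩
      x ⁻¹ * x * (y ⁻¹ * y) * z      ≈⟨ *-congʳ (*-cong (inverseˡ 1≤x) (inverseˡ 1≤y)) ⟩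
      1# * 1# * z                    ≈⟨ *-congʳ (*-identityʳ 1#) ⟩
      1# * z                         ≈⟨ *-identityˡ z ⟩
      z                              ∎
      where
      inverseˡ : ∀ {x} → 1# ≤ᶠ x → x ⁻¹ * x ≈ 1#
      inverseˡ {x} 1≤x = ≈-trans (*-comm (x ⁻¹) x) (⁻¹-inverseʳ x (1≤⇒≉0 1≤x))

    multiply : ∀ {w x y} → 1# ≤ᶠ x → w * x ⁻¹ ≤ᶠ y → w ≤ᶠ x * y
    multiply {w} {x} {y} 1≤x w/x≤y = begin
      w               ≈⟨ *-identityˡ w ⟨
      1# * w          ≈⟨ *-congʳ (⁻¹-inverseʳ x (1≤⇒≉0 1≤x)) ⟨
      x * x ⁻¹ * w    ≈⟨ *-assoc x (x ⁻¹) w ⟩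
      x * (x ⁻¹ * w)  ≈⟨ *-congˡ (*-comm (x ⁻¹) w) ⟩
      x * (w * x ⁻¹)  ≤⟨ *-monoʳ-≤ᶠ (≤ᶠ-trans 0≤1 1≤x) w/x≤y ⟩
      x * y           ∎

    module _ {N a b : ℕ} {κ : Carrier} (0<N : 0 < N) (0<a : 0 < a) (0<b : 0 < b) (1≤κ : 1# ≤ᶠ κ)
             (a≤κN : fromℕ a ≤ᶠ κ * fromℕ N) (N/κ≤b : fromℕ N * κ ⁻¹ ≤ᶠ fromℕ b) where

      -- K is the larger of `a / N` and `N / b`, rounded up. Both quotients are at most κ, so K is
      -- less than κ + 1 or equal to it.
      natural-parameter : ∃ λ K → 0 < K × a ≤ K *ℕ N × N ≤ K *ℕ b × fromℕ K ≤ᶠ fromℕ 2 * κ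
      natural-parameter with quotient 0<N 0<a | quotient 0<b 0<N
      ... | q , Nq<a , a≤N[1+q] | q′ , bq′<N , N≤b[1+q′] =
        suc (q ⊔ℕ q′) , s≤s z≤n ,
        enlarge a≤N[1+q] (ℕ.m≤m⊔n q q′) , enlarge N≤b[1+q′] (ℕ.m≤n⊔m q q′) ,
        suc≤2* (q ⊔ℕ q′) 1≤κ (q⊔q′≤κ (ℕ.⊔-sel q q′))
        where
        enlarge : ∀ {m n q r} → m ≤ n *ℕ suc q → q ≤ r → m ≤ suc r *ℕ n
        enlarge {n = n} {q} m≤n[1+q] q≤r =
          ℕ.≤-trans m≤n[1+q] (ℕ.≤-trans (ℕ.≤-reflexive (ℕ.*-comm n (suc q))) (ℕ.*-monoˡ-≤ n (s≤s q≤r)))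

        q⊔q′≤κ : ∀ {n} → n ≡ q ⊎ n ≡ q′ → fromℕ n ≤ᶠ κ
        q⊔q′≤κ (inj₁ ≡.refl) = *-≤⇒fromℕ≤ 0<N (ℕ.<⇒≤ Nq<a) a≤κN
        q⊔q′≤κ (inj₂ ≡.refl) = *-≤⇒fromℕ≤ 0<b (ℕ.<⇒≤ bq′<N) (multiply 1≤κ N/κ≤b)

    fromℕ≤polynomial : ∀ K {m n κ} → 1# ≤ᶠ κ → fromℕ K ≤ᶠ fromℕ 2 * κ →
      m ≤ 2 *ℕ (2 *ℕ K) ^ℕ degree *ℕ n → fromℕ m ≤ᶠ fromℕ absoluteConstant * κ ^ absoluteConstant * fromℕ n
    fromℕ≤polynomial K {m} {n} {κ} 1≤κ K≤2κ m≤ = begin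
      fromℕ m                                             ≤⟨ fromℕ-mono m≤ ⟩
      fromℕ (2 *ℕ (2 *ℕ K) ^ℕ degree *ℕ n)                ≈⟨ fromℕ-* (2 *ℕ (2 *ℕ K) ^ℕ degree) n ⟩
      fromℕ (2 *ℕ (2 *ℕ K) ^ℕ degree) * fromℕ n           ≤⟨ *-monoˡ-≤ᶠ (fromℕ-nonNeg n) (polynomial-bound degree K 1≤κ K≤2κ) ⟩
      fromℕ absoluteConstant * κ ^ absoluteConstant * fromℕ n ∎

theorem1p4 :
    (∀ {e : Level} → ExcludedMiddle e) →
    ∃AbsoluteConstant λ C →
      ∀ {c ℓ p f ℓ₁ ℓ₂ : Level}
        (R : RingWithoutOne c ℓ) (F : OrderedField f ℓ₁ ℓ₂) →
      let open SubsetsOf R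
          open OrderedField F
          |R| = RingWithoutOne.Carrier R
      in
      (A : Pred |R| p) (∣A∣ ∣A+AA∣ ∣AA∣ : ℕ) →
      Satisfiable A →
      ∣ A ∣≡ ∣A∣ →
      ∣ A ⊕ A ⊙ A ∣≡ ∣A+AA∣ →
      ∣ A ⊙ A ∣≡ ∣AA∣ →
      (K : Carrier) →
      1# ≤ K →
      fromℕ ∣A+AA∣ ≤ K * fromℕ ∣A∣ →
      fromℕ ∣A∣ * K ⁻¹ ≤ fromℕ ∣AA∣ →
      (∃ λ (z : ℕ) →
         ∣ (A ⊖ A) ∖ R* ∣≡ z ×
         (fromℕ C) ⁻¹ * (K ^ C) ⁻¹ * fromℕ ∣A∣ ≤ fromℕ z)
      ⊎
      (∃ λ (S : Pred |R| (c ⊔ ℓ)) →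
         IsSubring S × A ⊆ S ×
         (∃ λ (s : ℕ) → ∣ S ∣≡ s × fromℕ s ≤ fromℕ C * K ^ C * fromℕ ∣A∣))
theorem1p4 em .∃AbsoluteConstant.C   = SumProduct.absoluteConstant
theorem1p4 em .∃AbsoluteConstant.C>0 = SumProduct.0<absoluteConstant
theorem1p4 em .∃AbsoluteConstant.holds R F A N a b (x , x∈A) |A| |A+AA| |AA| κ 1≤κ a≤κN N/κ≤b =
  -- `x`, `x * x` and `x + x * x` show the three sets to be non-empty; the rounding that defines K
  -- requires positive cardinalities.
  let 0<N = ∣∣≡-positive x∈A |A|
      xx∈AA = x , x , x∈A , x∈A , R.refl
      0<a = ∣∣≡-positive (x , x R.* x , x∈A , xx∈AA , R.refl) |A+AA|
      0<b = ∣∣≡-positive xx∈AA |AA|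
      K , 0<K , a≤KN , N≤Kb , K≤2κ = natural-parameter 0<N 0<a 0<b 1≤κ a≤κN N/κ≤b
  in
  Sum.map
    (λ (z , |Z| , N≤) → z , |Z| ,
      divide (1≤fromℕ 0<absoluteConstant) (1≤^ 1≤κ absoluteConstant) (fromℕ≤polynomial K 1≤κ K≤2κ N≤))
    (λ (S , S-isSubring , A⊆S , s , |S| , s≤) → S , S-isSubring , A⊆S , s , |S| , fromℕ≤polynomial K 1≤κ K≤2κ s≤)
    (sum-product |A| |A+AA| |AA| 0<N 0<K a≤KN N≤Kb)
  where
  open SumProduct
  open Cardinality em R
  open OrderedFieldProperties F
  module R = RingWithoutOne R
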